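{- Let $H$ be a 1-extendable graph and let $G\in\mathcal{E}(H)$. Then $G$ is maximal in $(\mathcal{E}(H),\subseteq)$ if and only if each maximal barrier of $G$ is a clique in $G$, the set $\mathcal{P}(G)$ of maximal barriers of $G$ is a cover set of $H$, and $\mathcal{P}(G)$ is maximal in $(\mathcal{C}(H),\preceq)$.
   Context: All graphs are finite and simple. $\Phi(G)$ is the number of perfect matchings of $G$. An edge is extendable if it lies in some perfect matching. A connected graph is 1-extendable if every edge is extendable. For $S\subseteq V(G)$, $\operatorname{odd}(G-S)$ is the number of odd-order components of $G-S$; $S$ is a barrier of $G$ if $\operatorname{odd}(G-S)=|S|$ (the empty set counts as a barrier); maximal barriers are the inclusion-maximal ones, and $\mathcal{P}(G)$ is the set of maximal barriers of $G$. For a 1-extendable $H$, $\mathcal{E}(H)=\{G\supseteq H: V(G)=V(H),\ \Phi(G)=\Phi(H)\}$, ordered by the subgraph relation $\subseteq$. Two barriers $B_1,B_2$ of $H$ conflict if $B_1\cap B_2\neq\emptyset$, or $B_1$ intersects at least two components of $H-B_2$, or $B_2$ intersects at least two components of $H-B_1$. A cover set of $H$ is a set $\mathcal{I}$ of barriers of $H$ that are pairwise non-conflicting and that form a partition of $V(H)$; $\mathcal{C}(H)$ is the family of cover sets. For $\mathcal{I}_1,\mathcal{I}_2\in\mathcal{C}(H)$, $\mathcal{I}_1\preceq\mathcal{I}_2$ means every $B_1\in\mathcal{I}_1$ is contained in some $B_2\in\mathcal{I}_2$. -}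

module Defs where

open import Data.Nat using (ℕ; zero; suc; _≡ᵇ_; _%_)
open import Data.Bool using (Bool; true; false; _∧_; _∨_; not; if_then_else_)
open import Data.Fin using (Fin; _≟_; _<_)
open import Data.Fin.Subset using (Subset; _∈_; _∉_; _⊆_; ∣_∣)
open import Data.List using (List; []; _∷_; map; concatMap; length)
open import Data.Vec using (Vec; []; _∷_; lookup)
open import Data.Product using (Σ; ∃; ∃-syntax; _×_; _,_)
open import Data.Sum using (_⊎_)
open import Data.Fin.Base using (toℕ)
open import Data.List using () renaming (allFin to allFinL)
open import Relation.Nullary using (¬_)
open import Relation.Nullary.Decidable using (⌊_⌋)
open import Relation.Binary.PropositionalEquality using (_≡_)

boolFilter : ∀ {A : Set} → (A → Bool) → List A → List A
boolFilter p [] = []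
boolFilter p (x ∷ xs) = if p x then x ∷ boolFilter p xs else boolFilter p xs

all : ∀ {A : Set} → (A → Bool) → List A → Bool
all p [] = true
all p (x ∷ xs) = p x ∧ all p xs

any : ∀ {A : Set} → (A → Bool) → List A → Bool
any p [] = false
any p (x ∷ xs) = p x ∨ any p xs

record Graph (n : ℕ) : Set where
  field
    adj    : Fin n → Fin n → Bool
    sym    : ∀ u v → adj u v ≡ adj v u
    irrefl : ∀ v → adj v v ≡ false
open Graph public

Edge : ∀ {n} → Graph n → Fin n → Fin n → Set
Edge G u v = adj G u v ≡ true

_⊑_ : ∀ {n} → Graph n → Graph n → Set
G ⊑ G' = ∀ u v → Edge G u v → Edge G' u v

-- Perfect matchings, encoded as the partner map  m : Fin n → Fin n
-- (a fixed-point-free involution all of whose pairs {v, m v} are edges;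
-- fixed-point-freeness follows from irreflexivity of adj).

_==_ : ∀ {n} → Fin n → Fin n → Bool
u == v = ⌊ u ≟ v ⌋

isPMᵇ : ∀ {n} → Graph n → Vec (Fin n) n → Bool
isPMᵇ {n} G m =
  all (λ v → adj G v (lookup m v) ∧ (lookup m (lookup m v) == v)) (allFinL n)

IsPerfectMatching : ∀ {n} → Graph n → Vec (Fin n) n → Set
IsPerfectMatching G m = isPMᵇ G m ≡ true

allVecs : ∀ {n} (k : ℕ) → List (Vec (Fin n) k)
allVecs zero = [] ∷ []
allVecs {n} (suc k) = concatMap (λ x → map (x ∷_) (allVecs k)) (allFinL n)

Φ : ∀ {n} → Graph n → ℕ
Φ {n} G = length (boolFilter (isPMᵇ G) (allVecs n))

reachᵇ : ∀ {n} → Graph n → Subset n → ℕ → Fin n → Fin n → Bool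
reachᵇ G S zero u v = not (lookup S u) ∧ (u == v)
reachᵇ {n} G S (suc k) u v =
  reachᵇ G S k u v ∨
  any (λ w → reachᵇ G S k u w ∧ adj G w v ∧ not (lookup S v)) (allFinL n)

-- connᵇ G S u v : u and v lie in the same component of G - S
-- (walks of length ≤ n suffice on n vertices)
connᵇ : ∀ {n} → Graph n → Subset n → Fin n → Fin n → Bool
connᵇ {n} G S = reachᵇ G S n

emptySet : ∀ {n} → Subset n
emptySet {zero} = []
emptySet {suc n} = false ∷ emptySet

Connected : ∀ {n} → Graph n → Set
Connected G = ∀ u v → connᵇ G emptySet u v ≡ true

compSize : ∀ {n} → Graph n → Subset n → Fin n → ℕ
compSize {n} G S v = length (boolFilter (connᵇ G S v) (allFinL n))

isRepᵇ : ∀ {n} → Graph n → Subset n → Fin n → Bool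
isRepᵇ {n} G S v =
  not (lookup S v) ∧
  all (λ u → not (connᵇ G S u v) ∨ not (⌊ Data.Fin._<?_ u v ⌋)) (allFinL n)

isOddᵇ : ℕ → Bool
isOddᵇ k = (k % 2) ≡ᵇ 1

-- odd(G - S): number of odd-order components of G - S
-- (each component is counted once, via its least vertex)
odd : ∀ {n} → Graph n → Subset n → ℕ
odd {n} G S =
  length (boolFilter (λ v → isRepᵇ G S v ∧ isOddᵇ (compSize G S v)) (allFinL n))

Extendable : ∀ {n} → Graph n → Fin n → Fin n → Set
Extendable G u v = ∃[ m ] (IsPerfectMatching G m × lookup m u ≡ v)

OneExtendable : ∀ {n} → Graph n → Set
OneExtendable G =
  Connected G × (∃[ m ] IsPerfectMatching G m) ×
  (∀ u v → Edge G u v → Extendable G u v)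

Barrier : ∀ {n} → Graph n → Subset n → Set
Barrier G S = odd G S ≡ ∣ S ∣

MaxBarrier : ∀ {n} → Graph n → Subset n → Set
MaxBarrier G S = Barrier G S × (∀ T → Barrier G T → S ⊆ T → T ⊆ S)

Clique : ∀ {n} → Graph n → Subset n → Set
Clique G B = ∀ u v → u ∈ B → v ∈ B → ¬ (u ≡ v) → Edge G u v

Family : ℕ → Set₁
Family n = Subset n → Set

MeetsTwoComponents : ∀ {n} → Graph n → Subset n → Subset n → Set
MeetsTwoComponents H B₁ B₂ =
  ∃[ x ] ∃[ y ] (x ∈ B₁ × y ∈ B₁ × x ∉ B₂ × y ∉ B₂ ×
                 connᵇ H B₂ x y ≡ false)

Conflict : ∀ {n} → Graph n → Subset n → Subset n → Set
Conflict H B₁ B₂ =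
  (∃[ x ] (x ∈ B₁ × x ∈ B₂)) ⊎
  MeetsTwoComponents H B₁ B₂ ⊎
  MeetsTwoComponents H B₂ B₁

IsPartition : ∀ {n} → Family n → Set
IsPartition {n} 𝓘 =
  (∀ B → 𝓘 B → ∃[ x ] x ∈ B) ×
  (∀ (v : Fin n) → ∃[ B ] (𝓘 B × v ∈ B)) ×
  (∀ (v : Fin n) B B' → 𝓘 B → 𝓘 B' → v ∈ B → v ∈ B' → B ≡ B')

CoverSet : ∀ {n} → Graph n → Family n → Set
CoverSet H 𝓘 =
  (∀ B → 𝓘 B → Barrier H B) ×
  (∀ B₁ B₂ → 𝓘 B₁ → 𝓘 B₂ → ¬ (B₁ ≡ B₂) → ¬ Conflict H B₁ B₂) ×
  IsPartition 𝓘

_≼_ : ∀ {n} → Family n → Family n → Set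
𝓘₁ ≼ 𝓘₂ = ∀ B₁ → 𝓘₁ B₁ → ∃[ B₂ ] (𝓘₂ B₂ × B₁ ⊆ B₂)

MaximalCoverSet : ∀ {n} → Graph n → Family n → Set₁
MaximalCoverSet H 𝓘 =
  CoverSet H 𝓘 × (∀ 𝓙 → CoverSet H 𝓙 → 𝓘 ≼ 𝓙 → 𝓙 ≼ 𝓘)

InE : ∀ {n} → Graph n → Graph n → Set
InE H G = H ⊑ G × Φ G ≡ Φ H

MaximalInE : ∀ {n} → Graph n → Graph n → Set
MaximalInE H G = InE H G × (∀ G' → InE H G' → G ⊑ G' → G' ⊑ G)

{-# OPTIONS --safe #-}
-- Call x , y equivalent if x ≡ y or G - x - y has no perfect matching.  In any G with a perfect
-- matching two vertices of a barrier are equivalent, by counting odd components.  If G ∈ 𝓔(H), then the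
-- Kotzig–Lovász theorem holds: this is an equivalence relation whose classes are the maximal barriers.
-- Both halves follow by switching matchings along alternating paths, without Tutte's theorem:
-- transitivity because H is connected, and the barrier property because, as in Gallai's lemma, no two
-- edges of a perfect matching join a class S to the same component of G - S.
--
-- For G saturated (adding any edge creates a perfect matching) distinct equivalent vertices are exactly
-- those joined by an edge outside H, and the components of H - S and G - S coincide; hence 𝓟(G) is a
-- cover set of H by cliques.  Given a cover set 𝓙 coarser than 𝓟(G), completing its blocks to cliques
-- leaves the components of H - J unchanged for each J ∈ 𝓙, so the blocks remain barriers and no new
-- perfect matching appears; by maximality of G nothing was added, so 𝓙 ≼ 𝓟(G).  Conversely, saturate
-- any G′ ⊒ G in 𝓔(H) to K: then 𝓟(G) ≼ 𝓟(K), so 𝓟(K) ≼ 𝓟(G), and every edge of K outside H lies in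
-- a maximal barrier of G, which is a clique.
module Submission where

open import Defs
open import Data.Bool using (Bool; true; false; _∧_; _∨_; not)
import Data.Bool as Bool
open import Data.Bool.Properties using (not-involutive)
open import Data.Empty using (⊥; ⊥-elim)
open import Data.Fin using (Fin; zero; suc; _≟_) renaming (_<_ to _<ᶠ_; _<?_ to _<ᶠ?_)
open import Data.Fin.Induction using (<-wellFounded)
open import Data.Fin.Properties using (any?; <-cmp)
import Data.Fin.Properties as Fin
open import Data.Fin.Subset using (Subset; _∈_; _∉_; _⊆_; _⊂_; _⊃_; ∣_∣; _-_; _∪_; ⁅_⁆; inside; outside)
open import Data.Fin.Subset.Induction using (⊂-wellFounded; ⊃-wellFounded; Acc; acc)
open import Data.Fin.Subset.Properties using
  (_∈?_; nonempty?; Empty-unique; ∣⊥∣≡0; ∣p∣≤n; p─⊥≡p; p─q⊆p; p⊆p∪q; ⊂-trans; ⊆-antisym; p⊂q⇒∣p∣<∣q∣;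
   x∈p∧x≢y⇒x∈p-y; x∈p⇒p-x⊂p; x∈p⇒∣p-x∣<∣p∣; x∈p∪q⁺; x∈p∪q⁻; x∈⁅x⁆; x∈⁅y⁆⇒x≡y)
open import Data.List using (List; []; _∷_; length; cartesianProduct)
  renaming (allFin to allFinL; tabulate to tabulateL)
import Data.List as List
open import Data.List.Membership.Propositional using () renaming (_∈_ to _∈ˡ_; _∉_ to _∉ˡ_)
open import Data.List.Membership.Propositional.Properties using
  (∈-concatMap⁺; ∈-map⁺; ∈-allFin; ∈-cartesianProduct⁺)
open import Data.List.Relation.Unary.Any using (here; there)
import Data.List.Relation.Unary.Any as Any
open import Data.Nat using (ℕ; zero; suc; _≤_; _<_; z≤n; s≤s)
import Data.Nat as ℕ
open import Data.Nat.Properties using (m≤n⇒m≤1+n; <⇒≢; <⇒≱; suc-injective; ≤-trans; ≤-antisym)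
open import Data.Product using (∃; _×_; _,_; proj₁; proj₂)
open import Data.Sum using (_⊎_; inj₁; inj₂)
open import Data.Vec using (Vec; []; _∷_; tabulate; lookup)
import Data.Vec as Vec
open import Data.Vec.Properties using (lookup∘tabulate; lookup⇒[]=; []=⇒lookup)
open import Function using (_∘_; id)
open import Function.Bundles using (_⇔_; mk⇔)
open import Relation.Binary.Definitions using (tri<; tri≈; tri>)
open import Relation.Binary.PropositionalEquality using (_≡_; _≢_; refl; cong; cong₂; subst; trans)
  renaming (sym to ≡-sym)
open import Relation.Nullary using (¬_; yes; no; contradiction; Dec; does)
open import Relation.Nullary.Decidable using (⌊_⌋; _×-dec_; _⊎-dec_; ¬?; dec-true)

-- Boolean reflection and counting by filters.

true≢false : ∀ {b} → b ≡ true → b ≢ false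
true≢false refl ()

≢true⇒false : ∀ {b} → b ≢ true → b ≡ false
≢true⇒false {true} h = contradiction refl h
≢true⇒false {false} _ = refl

iff⇒≡ : ∀ {a b} → (a ≡ true → b ≡ true) → (b ≡ true → a ≡ true) → a ≡ b
iff⇒≡ {true} f g = ≡-sym (f refl)
iff⇒≡ {false} {true} f g = g refl
iff⇒≡ {false} {false} f g = refl

∧⁺ : ∀ {a b} → a ≡ true → b ≡ true → a ∧ b ≡ true
∧⁺ refl refl = refl

∧⁻ : ∀ {a b} → a ∧ b ≡ true → a ≡ true × b ≡ true
∧⁻ {true} {true} _ = refl , refl

∨⁺ : ∀ {a b} → a ≡ true ⊎ b ≡ true → a ∨ b ≡ true
∨⁺ (inj₁ refl) = refl
∨⁺ {true} (inj₂ _) = refl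
∨⁺ {false} (inj₂ refl) = refl

∨⁻ : ∀ {a b} → a ∨ b ≡ true → a ≡ true ⊎ b ≡ true
∨⁻ {true} _ = inj₁ refl
∨⁻ {false} h = inj₂ h

module _ {A : Set} where

  all⁺ : ∀ {p : A → Bool} xs → (∀ x → p x ≡ true) → all p xs ≡ true
  all⁺ [] h = refl
  all⁺ (x ∷ xs) h = ∧⁺ (h x) (all⁺ xs h)

  all⁻ : ∀ {p : A → Bool} {xs x} → all p xs ≡ true → x ∈ˡ xs → p x ≡ true
  all⁻ h (here refl) = proj₁ (∧⁻ h)
  all⁻ {p} {y ∷ _} h (there m) = all⁻ (proj₂ (∧⁻ {p y} h)) m

  any⁺ : ∀ {p : A → Bool} {xs x} → x ∈ˡ xs → p x ≡ true → any p xs ≡ true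
  any⁺ (here refl) h = ∨⁺ (inj₁ h)
  any⁺ {p} {y ∷ _} (there m) h = ∨⁺ {p y} (inj₂ (any⁺ m h))

  any⁻ : ∀ {p : A → Bool} xs → any p xs ≡ true → ∃ λ x → p x ≡ true
  any⁻ {p} (x ∷ xs) h with ∨⁻ {p x} h
  ... | inj₁ hx = x , hx
  ... | inj₂ hxs = any⁻ xs hxs

  filter-cong : ∀ {p q : A → Bool} → (∀ x → p x ≡ q x) → ∀ xs → boolFilter p xs ≡ boolFilter q xs
  filter-cong h [] = refl
  filter-cong {p} {q} h (x ∷ xs) rewrite h x with q x
  ... | true = cong (x ∷_) (filter-cong h xs)
  ... | false = filter-cong h xs

  module _ {p q : A → Bool} (p⇒q : ∀ x → p x ≡ true → q x ≡ true) where

    filter-mono : ∀ xs → length (boolFilter p xs) ≤ length (boolFilter q xs)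
    filter-mono [] = z≤n
    filter-mono (x ∷ xs) with p x in px | q x in qx
    ... | true | true = s≤s (filter-mono xs)
    ... | true | false = contradiction qx (true≢false (p⇒q x px))
    ... | false | true = m≤n⇒m≤1+n (filter-mono xs)
    ... | false | false = filter-mono xs

    -- As nothing is lost from `p` to `q`, equal lengths leave no room for a gain. With the tests
    -- for perfect matchings of `H` and `G`, this turns equality of `Φ` into agreement on every
    -- single matching.
    filter-saturated : ∀ {xs x} → length (boolFilter q xs) ≡ length (boolFilter p xs) →
                       x ∈ˡ xs → q x ≡ true → p x ≡ true
    filter-saturated {y ∷ xs} eq m h with p y in py | q y in qy
    filter-saturated {y ∷ xs} eq (here refl) h | true | _ = py
    filter-saturated {y ∷ xs} eq (there m) h | true | true = filter-saturated (suc-injective eq) m h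
    filter-saturated {y ∷ xs} eq m h | true | false = contradiction qy (true≢false (p⇒q y py))
    filter-saturated {y ∷ xs} eq m h | false | true =
      contradiction (≡-sym eq) (<⇒≢ (s≤s (filter-mono xs)))
    filter-saturated {y ∷ xs} eq (here refl) h | false | false = contradiction qy (true≢false h)
    filter-saturated {y ∷ xs} eq (there m) h | false | false = filter-saturated eq m h

    -- Locates an entry responsible for a changed count, so that an added edge which alters `Φ`
    -- yields an actual new perfect matching.
    filter-gain : ∀ xs → length (boolFilter q xs) ≢ length (boolFilter p xs) →
                  ∃ λ x → q x ≡ true × p x ≡ false
    filter-gain [] ne = contradiction refl ne
    filter-gain (x ∷ xs) ne with p x in px | q x in qx
    ... | true | true = filter-gain xs (ne ∘ cong suc)
    ... | true | false = contradiction qx (true≢false (p⇒q x px))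
    ... | false | true = x , qx , px
    ... | false | false = filter-gain xs ne

-- Cardinalities of subsets and parity.

length-filter-tabulate : ∀ {A : Set} {n} (p : A → Bool) (f : Fin n → A) →
  length (boolFilter p (tabulateL f)) ≡ ∣ tabulate (p ∘ f) ∣
length-filter-tabulate {n = zero} p f = refl
length-filter-tabulate {n = suc n} p f with p (f zero)
... | true = cong suc (length-filter-tabulate p (f ∘ suc))
... | false = length-filter-tabulate p (f ∘ suc)

module _ {n : ℕ} where

  ∈-tabulate⁺ : ∀ {p : Fin n → Bool} {v} → p v ≡ true → v ∈ tabulate p
  ∈-tabulate⁺ {p} {v} h = lookup⇒[]= v (tabulate p) (trans (lookup∘tabulate p v) h)

  ∈-tabulate⁻ : ∀ {p : Fin n → Bool} {v} → v ∈ tabulate p → p v ≡ true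
  ∈-tabulate⁻ {p} {v} h = trans (≡-sym (lookup∘tabulate p v)) ([]=⇒lookup h)

∣p∣≡1+∣p-x∣ : ∀ {n} {x : Fin n} {p} → x ∈ p → ∣ p ∣ ≡ suc ∣ p - x ∣
∣p∣≡1+∣p-x∣ {p = _ ∷ p} Vec.here = cong (suc ∘ ∣_∣) (≡-sym (p─⊥≡p p))
∣p∣≡1+∣p-x∣ {p = inside ∷ p} (Vec.there h) = cong suc (∣p∣≡1+∣p-x∣ h)
∣p∣≡1+∣p-x∣ {p = outside ∷ p} (Vec.there h) = ∣p∣≡1+∣p-x∣ h

x∉p-x : ∀ {n} {x : Fin n} {p} → x ∉ p - x
x∉p-x {x = zero} {_ ∷ p} ()
x∉p-x {x = suc x} {_ ∷ p} (Vec.there h) = x∉p-x h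

x∈p-y⇒x≢y : ∀ {n} {x y : Fin n} {p} → x ∈ p - y → x ≢ y
x∈p-y⇒x≢y h refl = x∉p-x h

-- A relation in place of a function lets images be chosen on `S` only. The induction deletes the
-- image of the first element from `T`; injectivity keeps the later images in what remains.
∣∣-mono-injective : ∀ {m n} (S : Subset m) (T : Subset n) (R : Fin m → Fin n → Set) →
  (∀ {u v t} → R u t → R v t → u ≡ v) →
  (∀ {v} → v ∈ S → ∃ λ t → t ∈ T × R v t) → ∣ S ∣ ≤ ∣ T ∣
∣∣-mono-injective [] T R inj im = z≤n
∣∣-mono-injective (outside ∷ S) T R inj im =
  ∣∣-mono-injective S T (R ∘ suc) (λ a b → Fin.suc-injective (inj a b)) (im ∘ Vec.there)
∣∣-mono-injective (inside ∷ S) T R inj im with im Vec.here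
... | t , t∈T , Rt = subst (suc ∣ S ∣ ≤_) (≡-sym (∣p∣≡1+∣p-x∣ t∈T))
  (s≤s (∣∣-mono-injective S (T - t) (R ∘ suc) (λ a b → Fin.suc-injective (inj a b)) im′))
  where
  im′ : ∀ {v} → v ∈ S → ∃ λ t′ → t′ ∈ T - t × R (suc v) t′
  im′ v∈S with im (Vec.there v∈S)
  ... | t′ , t′∈T , Rt′ = t′ , x∈p∧x≢y⇒x∈p-y t′∈T (λ { refl → Fin.0≢1+n (inj Rt Rt′) }) , Rt′

isOdd-suc : ∀ k → isOddᵇ (suc k) ≡ not (isOddᵇ k)
isOdd-suc zero = refl
isOdd-suc (suc zero) = refl
isOdd-suc (suc (suc k)) = isOdd-suc k

module _ {n : ℕ} (f : Fin n → Fin n) (invol : ∀ v → f (f v) ≡ v) where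

  -- Deleting the two-element orbit of `v` lowers the size by two and leaves a set closed under `f`.
  even-∣∣ : ∀ (P : Subset n) → (∀ {v} → v ∈ P → f v ∈ P) → (∀ {v} → v ∈ P → f v ≢ v) →
            isOddᵇ ∣ P ∣ ≡ false
  even-∣∣ P = go P (⊂-wellFounded P)
    where
    go : ∀ P → Acc _⊂_ P → (∀ {v} → v ∈ P → f v ∈ P) → (∀ {v} → v ∈ P → f v ≢ v) → isOddᵇ ∣ P ∣ ≡ false
    go P (acc rec) closed nofix with nonempty? P
    ... | no empty rewrite Empty-unique empty = trans (cong isOddᵇ (∣⊥∣≡0 n)) refl
    ... | yes (v , v∈P) =
      trans (cong isOddᵇ size) (go P′ (rec P′⊂P) closed′ (nofix ∘ P′⊆P))
      where
      fv∈ : f v ∈ P - v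
      fv∈ = x∈p∧x≢y⇒x∈p-y (closed v∈P) (nofix v∈P)
      P′ = P - v - f v
      P′⊆P : P′ ⊆ P
      P′⊆P = p─q⊆p P _ ∘ p─q⊆p (P - v) _
      P′⊂P : P′ ⊂ P
      P′⊂P = ⊂-trans (x∈p⇒p-x⊂p fv∈) (x∈p⇒p-x⊂p v∈P)
      size : ∣ P ∣ ≡ suc (suc ∣ P′ ∣)
      size = trans (∣p∣≡1+∣p-x∣ v∈P) (cong suc (∣p∣≡1+∣p-x∣ fv∈))
      closed′ : ∀ {u} → u ∈ P′ → f u ∈ P′
      closed′ {u} u∈ = x∈p∧x≢y⇒x∈p-y (x∈p∧x≢y⇒x∈p-y (closed (P′⊆P u∈)) fu≢v) fu≢fv
        where
        fu≢v : f u ≢ v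
        fu≢v e = x∈p-y⇒x≢y u∈ (trans (≡-sym (invol u)) (cong f e))
        fu≢fv : f u ≢ f v
        fu≢fv e = x∈p-y⇒x≢y (p─q⊆p (P - v) _ u∈) (trans (≡-sym (invol u)) (trans (cong f e) (invol v)))

-- Walks in `G - S` and correctness of the bounded search.

module _ {n : ℕ} where

  ==⁺ : ∀ {u v : Fin n} → u ≡ v → (u == v) ≡ true
  ==⁺ {u} {v} e with u ≟ v
  ... | yes _ = refl
  ... | no ne = contradiction e ne

  ==⁻ : ∀ {u v : Fin n} → (u == v) ≡ true → u ≡ v
  ==⁻ {u} {v} h with u ≟ v
  ... | yes e = e

  ∉⇒lookup : ∀ {v} {S : Subset n} → v ∉ S → not (lookup S v) ≡ true
  ∉⇒lookup {v} {S} v∉S with lookup S v in eq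
  ... | true = contradiction (lookup⇒[]= v S eq) v∉S
  ... | false = refl

  lookup⇒∉ : ∀ {v} {S : Subset n} → not (lookup S v) ≡ true → v ∉ S
  lookup⇒∉ {v} {S} h v∈S rewrite []=⇒lookup v∈S with h
  ... | ()

  edge? : ∀ (G : Graph n) u v → Dec (Edge G u v)
  edge? G u v = adj G u v Bool.≟ true

  edge-sym : ∀ (G : Graph n) {u v} → Edge G u v → Edge G v u
  edge-sym G {u} {v} e = trans (sym G v u) e

  edge⇒≢ : ∀ (G : Graph n) {u v} → Edge G u v → u ≢ v
  edge⇒≢ G e refl = true≢false e (irrefl G _)

  -- Walks without a length bound, so that concatenation and reversal need no arithmetic.
  data Reach (G : Graph n) (S : Subset n) (u : Fin n) : Fin n → Set where
    start : u ∉ S → Reach G S u u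
    step  : ∀ {w v} → Reach G S u w → Edge G w v → v ∉ S → Reach G S u v

  module _ {G : Graph n} {S : Subset n} where

    reach-source : ∀ {u v} → Reach G S u v → u ∉ S
    reach-source (start u∉S) = u∉S
    reach-source (step r _ _) = reach-source r

    reach-target : ∀ {u v} → Reach G S u v → v ∉ S
    reach-target (start u∉S) = u∉S
    reach-target (step _ _ v∉S) = v∉S

    reach-trans : ∀ {u v w} → Reach G S u v → Reach G S v w → Reach G S u w
    reach-trans r (start _) = r
    reach-trans r (step r′ e w∉S) = step (reach-trans r r′) e w∉S

    reach-sym : ∀ {u v} → Reach G S u v → Reach G S v u
    reach-sym (start u∉S) = start u∉S
    reach-sym (step r e v∉S) =
      reach-trans (step (start v∉S) (edge-sym G e) (reach-target r)) (reach-sym r)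

    reachᵇ-sound : ∀ k {u v} → reachᵇ G S k u v ≡ true → Reach G S u v
    reachᵇ-sound zero {u} h with ∧⁻ {not (lookup S u)} h
    ... | hu , he with ==⁻ he
    ...   | refl = start (lookup⇒∉ hu)
    reachᵇ-sound (suc k) {u} {v} h with ∨⁻ {reachᵇ G S k u v} h
    ... | inj₁ r = reachᵇ-sound k r
    ... | inj₂ r with any⁻ (allFinL n) r
    ...   | w , hw with ∧⁻ {reachᵇ G S k u w} hw
    ...     | rw , hv with ∧⁻ {adj G w v} hv
    ...       | e , v∉S = step (reachᵇ-sound k rw) e (lookup⇒∉ v∉S)

    module _ {u : Fin n} (u∉S : u ∉ S) where

      private
        R : ℕ → Subset n
        R k = tabulate (reachᵇ G S k u)

        Closed : ℕ → Set
        Closed k = ∀ {w v} → w ∈ R k → Edge G w v → v ∉ S → v ∈ R k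

        R-mono : ∀ k → R k ⊆ R (suc k)
        R-mono k v∈ = ∈-tabulate⁺ (∨⁺ (inj₁ (∈-tabulate⁻ v∈)))

        R-step : ∀ k {w v} → w ∈ R k → Edge G w v → v ∉ S → v ∈ R (suc k)
        R-step k {w} {v} w∈ e v∉S = ∈-tabulate⁺ (∨⁺ {reachᵇ G S k u v} (inj₂
          (any⁺ (∈-allFin w) (∧⁺ (∈-tabulate⁻ w∈) (∧⁺ e (∉⇒lookup v∉S))))))

        u∈R : ∀ k → u ∈ R k
        u∈R zero = ∈-tabulate⁺ (∧⁺ (∉⇒lookup u∉S) (==⁺ refl))
        u∈R (suc k) = R-mono k (u∈R k)

        stable⇒closed : ∀ k → R (suc k) ⊆ R k → Closed (suc k)
        stable⇒closed k stable w∈ e v∉S = R-mono k (stable (R-step k (stable w∈) e v∉S))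

        closed-suc : ∀ k → Closed k → Closed (suc k)
        closed-suc k closed = stable⇒closed k stable
          where
          stable : R (suc k) ⊆ R k
          stable {v} v∈ with ∨⁻ {reachᵇ G S k u v} (∈-tabulate⁻ v∈)
          ... | inj₁ r = ∈-tabulate⁺ r
          ... | inj₂ r with any⁻ (allFinL n) r
          ...   | w , hw with ∧⁻ {reachᵇ G S k u w} hw
          ...     | rw , hv with ∧⁻ {adj G w v} hv
          ...       | e , v∉S = closed (∈-tabulate⁺ rw) e (lookup⇒∉ v∉S)

        -- Until the reached set is closed, each round adds a vertex.
        growth : ∀ k → Closed k ⊎ k < ∣ R k ∣
        growth zero = inj₂ (subst (0 <_) (≡-sym (∣p∣≡1+∣p-x∣ (u∈R zero))) (s≤s z≤n))
        growth (suc k) with growth k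
        ... | inj₁ closed = inj₁ (closed-suc k closed)
        ... | inj₂ k< with any? (λ x → x ∈? R (suc k) ×-dec ¬? (x ∈? R k))
        ...   | yes new = inj₂ (≤-trans (s≤s k<) (p⊂q⇒∣p∣<∣q∣ (R-mono k , new)))
        ...   | no none = inj₁ (stable⇒closed k stable)
          where
          stable : R (suc k) ⊆ R k
          stable {x} x∈ with x ∈? R k
          ... | yes x∈R = x∈R
          ... | no x∉R = contradiction (x , x∈ , x∉R) none

        closed-n : Closed n
        closed-n with growth n
        ... | inj₁ closed = closed
        -- Without closure after `n` rounds, more than `n` vertices would have been reached.
        ... | inj₂ n< = contradiction (∣p∣≤n (R n)) (<⇒≱ n<)

        reach∈R : ∀ {v} → Reach G S u v → v ∈ R n
        reach∈R (start _) = u∈R n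
        reach∈R (step r e v∉S) = closed-n (reach∈R r) e v∉S

      reachᵇ-complete : ∀ {v} → Reach G S u v → connᵇ G S u v ≡ true
      reachᵇ-complete r = ∈-tabulate⁻ (reach∈R r)

    conn⇒reach : ∀ {u v} → connᵇ G S u v ≡ true → Reach G S u v
    conn⇒reach = reachᵇ-sound n

    reach⇒conn : ∀ {u v} → Reach G S u v → connᵇ G S u v ≡ true
    reach⇒conn r = reachᵇ-complete (reach-source r) r

  -- Perfect matchings and their number.

  ∈-allVecs : ∀ {k} (m : Vec (Fin n) k) → m ∈ˡ allVecs k
  ∈-allVecs [] = here refl
  ∈-allVecs {suc k} (x ∷ m) = ∈-concatMap⁺ (λ x → List.map (x ∷_) (allVecs k))
    (Any.map (λ { refl → ∈-map⁺ (x ∷_) (∈-allVecs m) }) (∈-allFin x))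

  Perfect : Graph n → (Fin n → Fin n) → Set
  Perfect G f = ∀ v → Edge G v (f v) × f (f v) ≡ v

  isPM⇒perfect : ∀ {G m} → isPMᵇ G m ≡ true → Perfect G (lookup m)
  isPM⇒perfect {G} {m} h v with ∧⁻ {adj G v (lookup m v)} (all⁻ h (∈-allFin v))
  ... | e , i = e , ==⁻ i

  perfect⇒isPM : ∀ {G m} → Perfect G (lookup m) → isPMᵇ G m ≡ true
  perfect⇒isPM h = all⁺ (allFinL n) (λ v → ∧⁺ (proj₁ (h v)) (==⁺ (proj₂ (h v))))

  perfect-cong : ∀ {G f g} → (∀ v → f v ≡ g v) → Perfect G f → Perfect G g
  perfect-cong {G} {f} {g} eq h v =
    subst (Edge G v) (eq v) (proj₁ (h v)) ,
    trans (≡-sym (trans (eq (f v)) (cong g (eq v)))) (proj₂ (h v))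

  perfect-mono : ∀ {G K f} → G ⊑ K → Perfect G f → Perfect K f
  perfect-mono G⊑K h v = G⊑K _ _ (proj₁ (h v)) , proj₂ (h v)

  isPM-mono : ∀ {G K} → G ⊑ K → ∀ m → isPMᵇ G m ≡ true → isPMᵇ K m ≡ true
  isPM-mono {G} {K} G⊑K m h = perfect⇒isPM {K} {m} (perfect-mono {G} {K} G⊑K (isPM⇒perfect {G} {m} h))

  -- The perfect matchings of `H` are among those of `G`, and the counts agree, so `G` has no
  -- others. Since `Φ` counts vectors, `f` is tabulated and looked up again.
  inE⇒perfect : ∀ {H G} → InE H G → ∀ {f} → Perfect G f → Perfect H f
  inE⇒perfect {H} {G} (H⊑G , eq) {f} h =
    perfect-cong {H} (lookup∘tabulate f) (isPM⇒perfect {H} {tabulate f}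
      (filter-saturated {p = isPMᵇ H} {isPMᵇ G} (isPM-mono {H} {G} H⊑G) eq (∈-allVecs (tabulate f))
        (perfect⇒isPM {G} {tabulate f} (perfect-cong {G} (≡-sym ∘ lookup∘tabulate f) h))))

  perfect⇒inE : ∀ {H G} → H ⊑ G → (∀ {f} → Perfect G f → Perfect H f) → InE H G
  perfect⇒inE {H} {G} H⊑G h = H⊑G , cong length (filter-cong
    (λ m → iff⇒≡ (λ p → perfect⇒isPM {H} {m} (h (isPM⇒perfect {G} {m} p)))
                 (isPM-mono {H} {G} H⊑G m)) (allVecs n))

  new-perfect : ∀ {H G} → H ⊑ G → Φ G ≢ Φ H → ∃ λ f → Perfect G f × ¬ Perfect H f
  new-perfect {H} {G} H⊑G ne with filter-gain {p = isPMᵇ H} {isPMᵇ G} (isPM-mono {H} {G} H⊑G) (allVecs n) ne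
  ... | m , pG , ¬pH = lookup m , isPM⇒perfect {G} {m} pG , λ pH → true≢false (perfect⇒isPM {H} {m} pH) ¬pH

  -- Partial matchings and operations on them.

  record Matching (G : Graph n) (f : Fin n → Fin n) : Set where
    field
      invol : ∀ v → f (f v) ≡ v
      edge  : ∀ {v} → f v ≢ v → Edge G v (f v)
  open Matching public

  -- The unmatched vertices of a partial matching are the fixed points of its involution. The list
  -- names exactly these, as a set: order and repetition do not matter.
  record Misses (f : Fin n → Fin n) (xs : List (Fin n)) : Set where
    field
      missed⇒∈ : ∀ {v} → f v ≡ v → v ∈ˡ xs
      ∈⇒missed : ∀ {v} → v ∈ˡ xs → f v ≡ v
  open Misses public

  perfect⇒matching : ∀ {G f} → Perfect G f → Matching G f
  perfect⇒matching h = record { invol = proj₂ ∘ h ; edge = λ _ → proj₁ (h _) }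

  perfect⇒misses : ∀ {G f} → Perfect G f → Misses f []
  perfect⇒misses {G} h = record
    { missed⇒∈ = λ {v} e → contradiction (≡-sym e) (edge⇒≢ G (proj₁ (h v))) ; ∈⇒missed = λ () }

  matching⇒perfect : ∀ {G f} → Matching G f → Misses f [] → Perfect G f
  matching⇒perfect M miss v = edge M (λ e → ∉[] (missed⇒∈ miss e)) , invol M v
    where
    ∉[] : ∀ {v : Fin n} → v ∉ˡ []
    ∉[] ()

  matching-mono : ∀ {G K f} → G ⊑ K → Matching G f → Matching K f
  matching-mono G⊑K M = record { invol = invol M ; edge = G⊑K _ _ ∘ edge M }

  injective : ∀ {G f} → Matching G f → ∀ {u v} → f u ≡ f v → u ≡ v
  injective {f = f} M {u} {v} e = trans (≡-sym (invol M u)) (trans (cong f e) (invol M v))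

  -- For distinct `x` and `y`, these are the perfect matchings of `G - x - y`, kept on the full
  -- vertex set.
  NearPerfect : Graph n → Fin n → Fin n → Set
  NearPerfect G x y = ∃ λ f → Matching G f × Misses f (x ∷ y ∷ [])

  misses-resp : ∀ {f xs ys} → (∀ {v} → v ∈ˡ xs → v ∈ˡ ys) → (∀ {v} → v ∈ˡ ys → v ∈ˡ xs) →
                Misses f xs → Misses f ys
  misses-resp to from miss = record
    { missed⇒∈ = to ∘ missed⇒∈ miss ; ∈⇒missed = ∈⇒missed miss ∘ from }

  near-sym : ∀ {G x y} → NearPerfect G x y → NearPerfect G y x
  near-sym (f , M , miss) = f , M , misses-resp flip flip miss
    where
    flip : ∀ {x y v : Fin n} → v ∈ˡ x ∷ y ∷ [] → v ∈ˡ y ∷ x ∷ []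
    flip (here e) = there (here e)
    flip (there (here e)) = here e

  near-mono : ∀ {G K x y} → G ⊑ K → NearPerfect G x y → NearPerfect K x y
  near-mono {G} {K} G⊑K (f , M , miss) = f , matching-mono {G} {K} G⊑K M , miss

  link : Fin n → Fin n → (Fin n → Fin n) → Fin n → Fin n
  link a b f v with v ≟ a
  ... | yes _ = b
  ... | no _ with v ≟ b
  ...   | yes _ = a
  ...   | no _ = f v

  link-left : ∀ a b f → link a b f a ≡ b
  link-left a b f with a ≟ a
  ... | yes _ = refl
  ... | no ne = contradiction refl ne

  link-right : ∀ a b f → link a b f b ≡ a
  link-right a b f with b ≟ a
  ... | yes e = e
  ... | no _ with b ≟ b
  ...   | yes _ = refl
  ...   | no ne = contradiction refl ne

  link-other : ∀ a b f {v} → v ≢ a → v ≢ b → link a b f v ≡ f v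
  link-other a b f {v} v≢a v≢b with v ≟ a
  ... | yes e = contradiction e v≢a
  ... | no _ with v ≟ b
  ...   | yes e = contradiction e v≢b
  ...   | no _ = refl

  module _ {G : Graph n} {f : Fin n → Fin n} {a b : Fin n} where

    link-matching : Matching G f → f a ≡ a → f b ≡ b → Edge G a b → Matching G (link a b f)
    link-matching M fa fb e = record { invol = invol′ ; edge = edge′ }
      where
      invol′ : ∀ v → link a b f (link a b f v) ≡ v
      invol′ v with v ≟ a
      ... | yes refl = link-right v b f
      ... | no v≢a with v ≟ b
      ...   | yes refl = link-left a v f
      ...   | no v≢b = trans (link-other a b f
                (λ e → v≢a (injective M (trans e (≡-sym fa))))
                (λ e → v≢b (injective M (trans e (≡-sym fb))))) (invol M v)
      edge′ : ∀ {v} → link a b f v ≢ v → Edge G v (link a b f v)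
      edge′ {v} ne with v ≟ a
      ... | yes refl = e
      ... | no v≢a with v ≟ b
      ...   | yes refl = edge-sym G e
      ...   | no v≢b = edge M ne

  link-misses : ∀ {f a b xs} → a ≢ b → a ∉ˡ xs → b ∉ˡ xs →
                Misses f (a ∷ b ∷ xs) → Misses (link a b f) xs
  link-misses {f} {a} {b} {xs} a≢b a∉ b∉ miss = record { missed⇒∈ = to ; ∈⇒missed = from }
    where
    to : ∀ {v} → link a b f v ≡ v → v ∈ˡ xs
    to {v} e with v ≟ a
    ... | yes refl = contradiction (≡-sym e) a≢b
    ... | no v≢a with v ≟ b
    ...   | yes refl = contradiction e a≢b
    ...   | no v≢b with missed⇒∈ miss e
    ...     | here v≡a = contradiction v≡a v≢a
    ...     | there (here v≡b) = contradiction v≡b v≢b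
    ...     | there (there v∈) = v∈
    from : ∀ {v} → v ∈ˡ xs → link a b f v ≡ v
    from v∈ = trans (link-other a b f (λ { refl → a∉ v∈ }) (λ { refl → b∉ v∈ }))
                    (∈⇒missed miss (there (there v∈)))

  unlink : Fin n → Fin n → (Fin n → Fin n) → Fin n → Fin n
  unlink a b f v with v ≟ a
  ... | yes _ = v
  ... | no _ with v ≟ b
  ...   | yes _ = v
  ...   | no _ = f v

  unlink-other : ∀ a b f {v} → v ≢ a → v ≢ b → unlink a b f v ≡ f v
  unlink-other a b f {v} v≢a v≢b with v ≟ a
  ... | yes e = contradiction e v≢a
  ... | no _ with v ≟ b
  ...   | yes e = contradiction e v≢b
  ...   | no _ = refl

  unlink-left : ∀ a b f → unlink a b f a ≡ a
  unlink-left a b f with a ≟ a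
  ... | yes _ = refl
  ... | no ne = contradiction refl ne

  unlink-right : ∀ a b f → unlink a b f b ≡ b
  unlink-right a b f with b ≟ a
  ... | yes e = refl
  ... | no _ with b ≟ b
  ...   | yes _ = refl
  ...   | no ne = contradiction refl ne

  module _ {G : Graph n} {f : Fin n → Fin n} {a b : Fin n} where

    unlink-matching : Matching G f → f a ≡ b → Matching G (unlink a b f)
    unlink-matching M fa = record { invol = invol′ ; edge = edge′ }
      where
      fb : f b ≡ a
      fb = trans (cong f (≡-sym fa)) (invol M a)
      invol′ : ∀ v → unlink a b f (unlink a b f v) ≡ v
      invol′ v with v ≟ a
      ... | yes refl = unlink-left v b f
      ... | no v≢a with v ≟ b
      ...   | yes refl = unlink-right a v f
      ...   | no v≢b = trans (unlink-other a b f
                (λ e → v≢b (injective M (trans e (≡-sym fb))))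
                (λ e → v≢a (injective M (trans e (≡-sym fa))))) (invol M v)
      edge′ : ∀ {v} → unlink a b f v ≢ v → Edge G v (unlink a b f v)
      edge′ {v} ne with v ≟ a
      ... | yes refl = contradiction refl ne
      ... | no v≢a with v ≟ b
      ...   | yes refl = contradiction refl ne
      ...   | no v≢b = edge M ne

  unlink-misses : ∀ {f a b xs} → Misses f xs → Misses (unlink a b f) (a ∷ b ∷ xs)
  unlink-misses {f} {a} {b} {xs} miss = record { missed⇒∈ = to ; ∈⇒missed = from }
    where
    to : ∀ {v} → unlink a b f v ≡ v → v ∈ˡ a ∷ b ∷ xs
    to {v} e with v ≟ a
    ... | yes v≡a = here v≡a
    ... | no _ with v ≟ b
    ...   | yes v≡b = there (here v≡b)
    ...   | no _ = there (there (missed⇒∈ miss e))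
    from : ∀ {v} → v ∈ˡ a ∷ b ∷ xs → unlink a b f v ≡ v
    from {v} v∈ with v ≟ a
    ... | yes _ = refl
    ... | no v≢a with v ≟ b
    ...   | yes _ = refl
    ...   | no v≢b with v∈
    ...     | here e = contradiction e v≢a
    ...     | there (here e) = contradiction e v≢b
    ...     | there (there v∈xs) = ∈⇒missed miss v∈xs

  matched⇒near : ∀ {G f u v} → Perfect G f → f u ≡ v → NearPerfect G u v
  matched⇒near {G} {f} {u} {v} h fu =
    unlink u v f , unlink-matching (perfect⇒matching {G} h) fu , unlink-misses (perfect⇒misses {G} h)

  -- The switching operation: on a set `P` closed under both maps it exchanges the edges of `f` for
  -- those of `g`.
  splice : Subset n → (Fin n → Fin n) → (Fin n → Fin n) → Fin n → Fin n
  splice P g f v with v ∈? P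
  ... | yes _ = g v
  ... | no _ = f v

  module _ {P : Subset n} {g f : Fin n → Fin n} where

    splice-in : ∀ {v} → v ∈ P → splice P g f v ≡ g v
    splice-in {v} v∈ with v ∈? P
    ... | yes _ = refl
    ... | no v∉ = contradiction v∈ v∉

    splice-out : ∀ {v} → v ∉ P → splice P g f v ≡ f v
    splice-out {v} v∉ with v ∈? P
    ... | yes v∈ = contradiction v∈ v∉
    ... | no _ = refl

    splice-matching : ∀ {G} → Matching G g → Matching G f →
      (∀ {v} → v ∈ P → g v ∈ P) → (∀ {v} → v ∈ P → f v ∈ P) → Matching G (splice P g f)
    splice-matching {G} Mg Mf closed-g closed-f = record { invol = invol′ ; edge = edge′ }
      where
      invol′ : ∀ v → splice P g f (splice P g f v) ≡ v
      invol′ v with v ∈? P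
      ... | yes v∈ = trans (splice-in (closed-g v∈)) (invol Mg v)
      ... | no v∉ = trans (splice-out (λ fv∈ → v∉ (subst (_∈ P) (invol Mf v) (closed-f fv∈)))) (invol Mf v)
      edge′ : ∀ {v} → splice P g f v ≢ v → Edge G v (splice P g f v)
      edge′ {v} ne with v ∈? P
      ... | yes v∈ = edge Mg ne
      ... | no v∉ = edge Mf ne

    splice-misses : ∀ {xs} →
      (∀ {v} → v ∈ P → g v ≡ v → v ∈ˡ xs) → (∀ {v} → v ∉ P → f v ≡ v → v ∈ˡ xs) →
      (∀ {v} → v ∈ˡ xs → (v ∈ P × g v ≡ v) ⊎ (v ∉ P × f v ≡ v)) → Misses (splice P g f) xs
    splice-misses {xs} in⇒ out⇒ from = record { missed⇒∈ = to ; ∈⇒missed = from′ }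
      where
      to : ∀ {v} → splice P g f v ≡ v → v ∈ˡ xs
      to {v} e with v ∈? P
      ... | yes v∈ = in⇒ v∈ e
      ... | no v∉ = out⇒ v∉ e
      from′ : ∀ {v} → v ∈ˡ xs → splice P g f v ≡ v
      from′ {v} v∈ with from v∈
      ... | inj₁ (v∈P , e) = trans (splice-in v∈P) e
      ... | inj₂ (v∉P , e) = trans (splice-out v∉P) e

  -- Alternating paths in the union of two matchings.

  PathEnds : (f g : Fin n → Fin n) (w : Fin n) → Subset n → Fin n → Set
  PathEnds f g w P e =
    (f e ≡ e × (∀ {v} → v ∈ P → f v ≡ v → v ≡ e) × (∀ {v} → v ∈ P → g v ≡ v → v ≡ w)) ⊎
    (g e ≡ e × (∀ {v} → v ∈ P → f v ≢ v) × (∀ {v} → v ∈ P → g v ≡ v → v ≡ w ⊎ v ≡ e))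

  -- Closure under both maps makes `P` fit for `splice`. The cases of `ends` tell which matching
  -- stops at `end`: in the first, replacing `f` by `g` on `P` moves a missed vertex from `end` to
  -- `w`; in the second, it makes both `w` and `end` missed.
  record AlternatingPath (f g : Fin n → Fin n) (w : Fin n) : Set where
    field
      P        : Subset n
      closed-f : ∀ {v} → v ∈ P → f v ∈ P
      closed-g : ∀ {v} → v ∈ P → g v ∈ P
      w∈P      : w ∈ P
      end      : Fin n
      end∈P    : end ∈ P
      end≢w    : end ≢ w
      ends     : PathEnds f g w P end

  module _ (f g : Fin n → Fin n) (f-invol : ∀ v → f (f v) ≡ v) (g-invol : ∀ v → g (g v) ≡ v)
           {w : Fin n} (gw : g w ≡ w) (fw : f w ≢ w) where

    private
      h : Bool → Fin n → Fin n
      h true = f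
      h false = g

      h-invol : ∀ i v → h i (h i v) ≡ v
      h-invol true = f-invol
      h-invol false = g-invol

      -- P is the part of the path walked so far, p its last vertex, and h i the next step.
      record Walk (P : Subset n) (p : Fin n) (i : Bool) : Set where
        field
          done   : ∀ {v} → v ∈ P → h (not i) v ∈ P
          next   : ∀ {v} → v ∈ P → v ≢ p → h i v ∈ P × h i v ≢ p
          fix    : ∀ {v} → v ∈ P → h (not i) v ≡ v → v ≡ w × i ≡ true
          fix-next : ∀ {v} → v ∈ P → v ≢ p → h i v ≡ v → v ≡ w × i ≡ false
          tip    : i ≡ true ⊎ p ≢ w
          p∈     : p ∈ P
          w∈     : w ∈ P
      open Walk

      tip≢w : ∀ {P p i} → Walk P p i → h i p ≡ p → p ≢ w
      tip≢w W e refl with tip W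
      ... | inj₁ refl = fw e
      ... | inj₂ ne = ne refl

      finish : ∀ {P p} i → Walk P p i → h i p ≡ p → AlternatingPath f g w
      finish {P} {p} i W e = record
        { P = P ; closed-f = closed true i refl ; closed-g = closed false i refl
        ; w∈P = w∈ W ; end = p ; end∈P = p∈ W ; end≢w = tip≢w W e ; ends = ends′ i W e }
        where
        closedᵢ : ∀ {v} → v ∈ P → h i v ∈ P
        closedᵢ {v} v∈ with v ≟ p
        ... | yes refl = subst (_∈ P) (≡-sym e) v∈
        ... | no v≢p = proj₁ (next W v∈ v≢p)
        closed : ∀ j k → k ≡ i → ∀ {v} → v ∈ P → h j v ∈ P
        closed true true refl = closedᵢ
        closed true false refl = done W
        closed false true refl = done W
        closed false false refl = closedᵢ
        ends′ : ∀ i → Walk P p i → h i p ≡ p → PathEnds f g w P p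
        ends′ true W e = inj₁ (e , fixf , λ v∈ e′ → proj₁ (fix W v∈ e′))
          where
          fixf : ∀ {v} → v ∈ P → f v ≡ v → v ≡ p
          fixf {v} v∈ e′ with v ≟ p
          ... | yes v≡p = v≡p
          ... | no v≢p with fix-next W v∈ v≢p e′
          ...   | _ , ()
        ends′ false W e = inj₂ (e , nofix , fixg)
          where
          nofix : ∀ {v} → v ∈ P → f v ≢ v
          nofix v∈ e′ with fix W v∈ e′
          ... | _ , ()
          fixg : ∀ {v} → v ∈ P → g v ≡ v → v ≡ w ⊎ v ≡ p
          fixg {v} v∈ e′ with v ≟ p
          ... | yes v≡p = inj₂ v≡p
          ... | no v≢p = inj₁ (proj₁ (fix-next W v∈ v≢p e′))

      -- The walk stops at a vertex fixed by the matching whose turn it is; otherwise the visited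
      -- set grows strictly, which ends the recursion.
      go : ∀ P → Acc _⊃_ P → ∀ p i → Walk P p i → AlternatingPath f g w
      go P (acc rec) p i W with h i p ≟ p
      ... | yes e = finish i W e
      ... | no q≢p = go P′ (rec (p⊆p∪q ⁅ q ⁆ , q , q∈P′ , q∉P)) q (not i) W′
        where
        q = h i p
        P′ = P ∪ ⁅ q ⁆
        q∈P′ : q ∈ P′
        q∈P′ = x∈p∪q⁺ (inj₂ (x∈⁅x⁆ q))
        old : P ⊆ P′
        old = p⊆p∪q ⁅ q ⁆
        hq : h i q ≡ p
        hq = h-invol i p
        -- The vertex `q` is new: `h i` sends it back to `p`, whereas `next` forbids this for every
        -- visited vertex other than `p`.
        q∉P : q ∉ P
        q∉P q∈ = proj₂ (next W q∈ q≢p) hq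
        cases : ∀ {v} → v ∈ P′ → v ∈ P ⊎ v ≡ q
        cases v∈ with x∈p∪q⁻ P ⁅ q ⁆ v∈
        ... | inj₁ v∈P = inj₁ v∈P
        ... | inj₂ v∈q = inj₂ (x∈⁅y⁆⇒x≡y q v∈q)
        cases′ : ∀ {v} → v ∈ P′ → v ≢ q → v ∈ P
        cases′ v∈ v≢q with cases v∈
        ... | inj₁ v∈P = v∈P
        ... | inj₂ v≡q = contradiction v≡q v≢q
        doneᵢ : ∀ {v} → v ∈ P′ → h i v ∈ P′
        doneᵢ {v} v∈ with cases v∈
        ... | inj₂ refl = subst (_∈ P′) (≡-sym hq) (old (p∈ W))
        ... | inj₁ v∈P with v ≟ p
        ...   | yes refl = q∈P′
        ...   | no v≢p = old (proj₁ (next W v∈P v≢p))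
        fixᵢ : ∀ {v} → v ∈ P′ → h i v ≡ v → v ≡ w × not i ≡ true
        fixᵢ {v} v∈ e with cases v∈
        ... | inj₂ refl = contradiction (trans (≡-sym e) hq) q≢p
        ... | inj₁ v∈P with v ≟ p
        ...   | yes refl = contradiction e q≢p
        ...   | no v≢p with fix-next W v∈P v≢p e
        ...     | v≡w , i≡ = v≡w , cong not i≡
        W′ : Walk P′ q (not i)
        W′ = record
          -- The matchings exchange roles: the old `next`, completed by the step from `p`, becomes
          -- `done`, and the old `done` becomes `next`.
          { done = λ {v} v∈ → subst (λ j → h j v ∈ P′) (≡-sym (not-involutive i)) (doneᵢ v∈)
          ; next = λ v∈ v≢q → let r = done W (cases′ v∈ v≢q) in old r , λ { eq → q∉P (subst (_∈ P) eq r) }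
          ; fix = λ {v} v∈ e → fixᵢ v∈ (subst (λ j → h j v ≡ v) (not-involutive i) e)
          ; fix-next = λ v∈ v≢q e → let (v≡w , i≡) = fix W (cases′ v∈ v≢q) e in v≡w , cong not i≡
          ; tip = inj₂ (λ { q≡w → q∉P (subst (_∈ P) (≡-sym q≡w) (w∈ W)) })
          ; p∈ = q∈P′
          ; w∈ = old (w∈ W) }

    alternating-path : AlternatingPath f g w
    alternating-path = go ⁅ w ⁆ (⊃-wellFounded ⁅ w ⁆) w true record
      { done = λ v∈ → subst (_∈ ⁅ w ⁆) (≡-sym (trans (cong g (is-w v∈)) gw)) (x∈⁅x⁆ w)
      ; next = λ v∈ v≢w → contradiction (is-w v∈) v≢w
      ; fix = λ v∈ _ → is-w v∈ , refl
      ; fix-next = λ v∈ v≢w → contradiction (is-w v∈) v≢w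
      ; tip = inj₁ refl
      ; p∈ = x∈⁅x⁆ w
      ; w∈ = x∈⁅x⁆ w }
      where
      is-w : ∀ {v} → v ∈ ⁅ w ⁆ → v ≡ w
      is-w = x∈⁅y⁆⇒x≡y w

-- Odd components and barriers.

does⁻ : ∀ {A : Set} (d : Dec A) → does d ≡ true → A
does⁻ (yes a) _ = a
does⁻ (no _) ()

module _ {n : ℕ} where

  module _ (G : Graph n) (S : Subset n) where

    component : Fin n → Subset n
    component v = tabulate (connᵇ G S v)

    oddReps : Subset n
    oddReps = tabulate (λ v → isRepᵇ G S v ∧ isOddᵇ (compSize G S v))

    odd≡∣oddReps∣ : odd G S ≡ ∣ oddReps ∣
    odd≡∣oddReps∣ = length-filter-tabulate (λ v → isRepᵇ G S v ∧ isOddᵇ (compSize G S v)) id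

    compSize≡ : ∀ v → compSize G S v ≡ ∣ component v ∣
    compSize≡ v = length-filter-tabulate (connᵇ G S v) id

    IsRep : Fin n → Set
    IsRep v = v ∉ S × (∀ {u} → Reach G S u v → ¬ u <ᶠ v)

  module _ {G : Graph n} {S : Subset n} where

    ∈component⁺ : ∀ {u v} → Reach G S u v → v ∈ component G S u
    ∈component⁺ r = ∈-tabulate⁺ (reach⇒conn r)

    ∈component⁻ : ∀ {u v} → v ∈ component G S u → Reach G S u v
    ∈component⁻ v∈ = conn⇒reach (∈-tabulate⁻ v∈)

    isRepᵇ⇒IsRep : ∀ {v} → isRepᵇ G S v ≡ true → IsRep G S v
    isRepᵇ⇒IsRep {v} h with ∧⁻ {not (lookup S v)} h
    ... | v∉ , least = lookup⇒∉ v∉ , not-less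
      where
      not-less : ∀ {u} → Reach G S u v → ¬ u <ᶠ v
      not-less {u} r u<v with ∨⁻ {not (connᵇ G S u v)} (all⁻ least (∈-allFin u))
      ... | inj₁ e rewrite reach⇒conn r with e
      ...   | ()
      not-less {u} r u<v | inj₂ e with u <ᶠ? v
      ... | yes _ with e
      ...   | ()
      not-less {u} r u<v | inj₂ e | no u≮v = u≮v u<v

    IsRep⇒isRepᵇ : ∀ {v} → IsRep G S v → isRepᵇ G S v ≡ true
    IsRep⇒isRepᵇ {v} (v∉ , least) = ∧⁺ (∉⇒lookup v∉) (all⁺ (allFinL n) not-less)
      where
      not-less : ∀ u → not (connᵇ G S u v) ∨ not (⌊ u <ᶠ? v ⌋) ≡ true
      not-less u with connᵇ G S u v in c
      ... | false = refl
      ... | true with u <ᶠ? v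
      ...   | yes u<v = contradiction u<v (least (conn⇒reach c))
      ...   | no _ = refl

    rep-unique : ∀ {u v} → IsRep G S u → IsRep G S v → Reach G S u v → u ≡ v
    rep-unique {u} {v} (_ , least-u) (_ , least-v) r with <-cmp u v
    ... | tri< u<v _ _ = contradiction u<v (least-v r)
    ... | tri≈ _ e _ = e
    ... | tri> _ _ v<u = contradiction v<u (least-u (reach-sym r))

    rep-exists : ∀ {v} → v ∉ S → ∃ λ r → IsRep G S r × Reach G S v r
    rep-exists {v} = go v (<-wellFounded v)
      where
      go : ∀ v → Acc _<ᶠ_ v → v ∉ S → ∃ λ r → IsRep G S r × Reach G S v r
      go v (acc rec) v∉ with any? (λ u → u <ᶠ? v ×-dec connᵇ G S u v Bool.≟ true)
      ... | yes (u , u<v , c) with go u (rec u<v) (reach-source (conn⇒reach c))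
      ...   | r , rep , reach = r , rep , reach-trans (reach-sym (conn⇒reach c)) reach
      go v (acc rec) v∉ | no none = v , (v∉ , λ {u} r u<v → none (u , u<v , reach⇒conn r)) , start v∉

    -- Otherwise `f` would restrict to an involution without fixed points on the component, whose
    -- size would then be even.
    odd⇒leaves : ∀ {f v} → Matching G f → (∀ {u} → f u ≡ u → u ∈ S) →
                 isOddᵇ ∣ component G S v ∣ ≡ true → ∃ λ u → Reach G S v u × f u ∈ S
    odd⇒leaves {f} {v} M missed isodd with any? (λ u → u ∈? component G S v ×-dec f u ∈? S)
    ... | yes (u , u∈ , fu∈) = u , ∈component⁻ u∈ , fu∈
    ... | no none = contradiction (even-∣∣ f (invol M) (component G S v) closed nofix) (true≢false isodd)
      where
      nofix : ∀ {u} → u ∈ component G S v → f u ≢ u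
      nofix u∈ e = reach-target (∈component⁻ u∈) (missed e)
      closed : ∀ {u} → u ∈ component G S v → f u ∈ component G S v
      closed {u} u∈ = ∈component⁺ (step (∈component⁻ u∈) (edge M (nofix u∈)) (λ fu∈ → none (u , u∈ , fu∈)))

    -- Each odd component is charged to a vertex of `T` matched into it; components charged to the
    -- same vertex share its partner and so coincide. A `T` smaller than `S` is what later
    -- contradicts a near-perfect matching.
    odd≤ : ∀ {f T} → Matching G f → (∀ {v} → f v ≡ v → v ∈ S) →
           (∀ {v} → v ∉ S → f v ∈ S → f v ∈ T) → odd G S ≤ ∣ T ∣
    odd≤ {f} {T} M missed into = subst (_≤ ∣ T ∣) (≡-sym (odd≡∣oddReps∣ G S))
      (∣∣-mono-injective (oddReps G S) T Leaves leaves-inj leaves)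
      where
      Leaves : Fin n → Fin n → Set
      Leaves v t = IsRep G S v × ∃ λ u → Reach G S v u × f u ≡ t
      leaves-inj : ∀ {u v t} → Leaves u t → Leaves v t → u ≡ v
      leaves-inj (rep-u , a , u→a , fa) (rep-v , b , v→b , fb) with injective M (trans fa (≡-sym fb))
      ... | refl = rep-unique rep-u rep-v (reach-trans u→a (reach-sym v→b))
      leaves : ∀ {v} → v ∈ oddReps G S → ∃ λ t → t ∈ T × Leaves v t
      leaves {v} v∈ with ∧⁻ {isRepᵇ G S v} (∈-tabulate⁻ v∈)
      ... | rep , isodd with odd⇒leaves M missed (trans (cong isOddᵇ (≡-sym (compSize≡ G S v))) isodd)
      ...   | u , v→u , fu∈ = f u , into (reach-target v→u) fu∈ , isRepᵇ⇒IsRep rep , u , v→u , refl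

    perfect⇒odd≤ : ∀ {f} → Perfect G f → odd G S ≤ ∣ S ∣
    perfect⇒odd≤ h = odd≤ (perfect⇒matching {G = G} h)
      (λ {v} e → contradiction (≡-sym e) (edge⇒≢ G (proj₁ (h v)))) (λ _ → id)

    -- As `s` is itself unmatched, the odd components inject into `S - s`, which has one vertex too
    -- few.
    barrier⇒¬near : Barrier G S → ∀ {s t} → s ∈ S → t ∈ S → ¬ NearPerfect G s t
    barrier⇒¬near barrier {s} {t} s∈ t∈ (f , M , miss) =
      <⇒≱ (x∈p⇒∣p-x∣<∣p∣ s∈) (subst (_≤ ∣ S - s ∣) barrier (odd≤ M missed into))
      where
      missed : ∀ {v} → f v ≡ v → v ∈ S
      missed e with missed⇒∈ miss e
      ... | here refl = s∈
      ... | there (here refl) = t∈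
      into : ∀ {v} → v ∉ S → f v ∈ S → f v ∈ S - s
      into {v} v∉ fv∈ = x∈p∧x≢y⇒x∈p-y fv∈ λ { e →
        v∉ (subst (_∈ S) (trans (≡-sym (∈⇒missed miss (here refl))) (trans (cong f (≡-sym e)) (invol M v))) s∈) }

  odd-cong : ∀ {G K : Graph n} {S} → (∀ {u v} → Reach G S u v → Reach K S u v) →
             (∀ {u v} → Reach K S u v → Reach G S u v) → odd G S ≡ odd K S
  odd-cong {G} {K} {S} to from = cong length (filter-cong (λ v → cong₂ _∧_ (rep v) (cong isOddᵇ (size v))) (allFinL n))
    where
    conn≡ : ∀ u v → connᵇ G S u v ≡ connᵇ K S u v
    conn≡ u v = iff⇒≡ (λ c → reach⇒conn (to (conn⇒reach c))) (λ c → reach⇒conn (from (conn⇒reach c)))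
    size : ∀ v → compSize G S v ≡ compSize K S v
    size v = cong length (filter-cong (conn≡ v) (allFinL n))
    rep : ∀ v → isRepᵇ G S v ≡ isRepᵇ K S v
    rep v = iff⇒≡
      (λ h → let (v∉ , least) = isRepᵇ⇒IsRep {G} h in IsRep⇒isRepᵇ {K} (v∉ , least ∘ from))
      (λ h → let (v∉ , least) = isRepᵇ⇒IsRep {K} h in IsRep⇒isRepᵇ {G} (v∉ , least ∘ to))

  reach-mono : ∀ {G K : Graph n} {S u v} → G ⊑ K → Reach G S u v → Reach K S u v
  reach-mono G⊑K (start u∉) = start u∉
  reach-mono G⊑K (step r e v∉) = step (reach-mono G⊑K r) (G⊑K _ _ e) v∉

  -- A perfect matching through an added edge `x y` is that edge plus a perfect matching of
  -- `G - x - y`, so the property can be stated inside `G`.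
  Saturated : Graph n → Set
  Saturated G = ∀ x y → x ≢ y → Edge G x y ⊎ NearPerfect G x y

  extend : ∀ {H : Graph n} → OneExtendable H → ∀ {u v : Fin n} → Edge H u v → ∃ λ f → Perfect H f × f u ≡ v
  extend {H} (_ , _ , ext) {u} {v} e with ext u v e
  ... | m , pm , mu = lookup m , isPM⇒perfect {G = H} {m} pm , mu

  -- Equivalence of vertices in a saturated graph.

  module Kotzig {H G : Graph n} (oneExt : OneExtendable H) (inE : InE H G) (sat : Saturated G) where

    H⊑G = proj₁ inE

    infix 4 _≈_ _≈?_

    -- Given by adjacency, hence decidable. For distinct vertices, `≈⇒¬near` and `≉⇒near` identify
    -- it with the absence of a matching missing just `x` and `y`.
    _≈_ : Fin n → Fin n → Set
    x ≈ y = x ≡ y ⊎ (Edge G x y × ¬ Edge H x y)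

    _≈?_ : ∀ x y → Dec (x ≈ y)
    x ≈? y = x ≟ y ⊎-dec (edge? G x y ×-dec ¬? (edge? H x y))

    ≈-sym : ∀ {x y} → x ≈ y → y ≈ x
    ≈-sym (inj₁ e) = inj₁ (≡-sym e)
    ≈-sym (inj₂ (e , ne)) = inj₂ (edge-sym G e , ne ∘ edge-sym H)

    edge⇒near : ∀ {x y} → Edge H x y → NearPerfect G x y
    edge⇒near e with extend {H} oneExt e
    ... | f , perf , fx = near-mono {G = H} {K = G} H⊑G (matched⇒near {G = H} perf fx)

    -- Adding the edge `x y` to such a matching would give a perfect matching of `G`, hence of `H`,
    -- that contains an edge outside `H`.
    ≈⇒¬near : ∀ {x y} → x ≈ y → x ≢ y → ¬ NearPerfect G x y
    ≈⇒¬near (inj₁ e) ne _ = ne e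
    ≈⇒¬near {x} {y} (inj₂ (e , ¬eH)) ne (f , M , miss) =
      ¬eH (subst (Edge H x) (link-left x y f) (proj₁ (inE⇒perfect {H = H} {G} inE perf x)))
      where
      perf : Perfect G (link x y f)
      perf = matching⇒perfect
        (link-matching M (∈⇒missed miss (here refl)) (∈⇒missed miss (there (here refl))) e)
        (link-misses ne (λ ()) (λ ()) miss)

    ≉⇒near : ∀ {x y} → ¬ x ≈ y → NearPerfect G x y
    ≉⇒near {x} {y} ne with sat x y (ne ∘ inj₁)
    ... | inj₂ near = near
    ... | inj₁ e with edge? H x y
    ...   | yes eH = edge⇒near eH
    ...   | no ¬eH = contradiction (inj₂ (e , ¬eH)) ne

    -- If d ≉ b, switch a matching missing a , c along the path that starts at b in its union with a
    -- matching missing b , d: the result misses b , c or a , b, or the edge a d can be added to it.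
    neighbour : ∀ {a b c d} → a ≈ b → a ≢ b → c ≈ b → c ≢ b → a ≢ c → NearPerfect G a c →
                Edge G a d → d ≢ b → d ≈ b
    neighbour {a} {b} {c} {d} a≈b a≢b c≈b c≢b a≢c (f , Mf , miss-f) e d≢b with d ≈? b
    ... | yes d≈b = d≈b
    ... | no d≉b with ≉⇒near (d≉b ∘ ≈-sym)
    ...   | g , Mg , miss-g = ⊥-elim (bad (alternating-path f g (invol Mf) (invol Mg) gb fb))
      where
      fa = ∈⇒missed miss-f (here refl)
      fc = ∈⇒missed miss-f (there (here refl))
      gb = ∈⇒missed miss-g (here refl)
      gd = ∈⇒missed miss-g (there (here refl))
      a≢d : a ≢ d
      a≢d = edge⇒≢ G e
      c≢d : c ≢ d
      c≢d refl = d≉b c≈b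
      fb : f b ≢ b
      fb eq with missed⇒∈ miss-f eq
      ... | here b≡a = a≢b (≡-sym b≡a)
      ... | there (here b≡c) = c≢b (≡-sym b≡c)
      bad : AlternatingPath f g b → ⊥
      bad record
        { P = P ; closed-f = closed-f ; closed-g = closed-g ; w∈P = w∈P
        ; end = end ; end∈P = end∈P ; end≢w = end≢w ; ends = ends } = bad-ends ends
        where
        h = splice P g f
        Mh : Matching G h
        Mh = splice-matching Mg Mf closed-g closed-f
        bad-ends : PathEnds f g b P end → ⊥
        bad-ends (inj₁ (fe , onlyf , onlyg)) with missed⇒∈ miss-f fe
        ... | here refl = ≈⇒¬near c≈b c≢b (near-sym {G = G} (h , Mh , splice-misses
              (λ v∈ gv → here (onlyg v∈ gv))
              (λ v∉ fv → out v∉ fv)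
              (λ { (here refl) → inj₁ (w∈P , gb) ; (there (here refl)) → inj₂ ((λ c∈ → a≢c (≡-sym (onlyf c∈ fc))) , fc) })))
          where
          out : ∀ {v} → v ∉ P → f v ≡ v → v ∈ˡ b ∷ c ∷ []
          out v∉ fv with missed⇒∈ miss-f fv
          ... | here refl = contradiction end∈P v∉
          ... | there (here refl) = there (here refl)
        ... | there (here refl) = ≈⇒¬near a≈b a≢b (near-sym {G = G} (h , Mh , splice-misses
              (λ v∈ gv → here (onlyg v∈ gv))
              (λ v∉ fv → out v∉ fv)
              (λ { (here refl) → inj₁ (w∈P , gb) ; (there (here refl)) → inj₂ ((λ a∈ → a≢c (onlyf a∈ fa)) , fa) })))
          where
          out : ∀ {v} → v ∉ P → f v ≡ v → v ∈ˡ b ∷ a ∷ []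
          out v∉ fv with missed⇒∈ miss-f fv
          ... | here refl = there (here refl)
          ... | there (here refl) = contradiction end∈P v∉
        bad-ends (inj₂ (ge , nof , onlyg)) with missed⇒∈ miss-g ge
        ... | here refl = end≢w refl
        ... | there (here refl) = ≈⇒¬near c≈b c≢b (near-sym {G = G} (link a d h ,
                link-matching Mh (∈⇒missed miss (here refl)) (∈⇒missed miss (there (here refl))) e ,
                link-misses a≢d
                  (λ { (here a≡b) → a≢b a≡b ; (there (here a≡c)) → a≢c a≡c })
                  (λ { (here d≡b) → d≢b d≡b ; (there (here d≡c)) → c≢d (≡-sym d≡c) }) miss))
          where
          out : ∀ {v} → v ∉ P → f v ≡ v → v ∈ˡ a ∷ d ∷ b ∷ c ∷ []
          out v∉ fv with missed⇒∈ miss-f fv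
          ... | here refl = here refl
          ... | there (here refl) = there (there (there (here refl)))
          inn : ∀ {v} → v ∈ P → g v ≡ v → v ∈ˡ a ∷ d ∷ b ∷ c ∷ []
          inn v∈ gv with onlyg v∈ gv
          ... | inj₁ refl = there (there (here refl))
          ... | inj₂ refl = there (here refl)
          miss : Misses h (a ∷ d ∷ b ∷ c ∷ [])
          miss = splice-misses inn out λ
            { (here refl) → inj₂ ((λ a∈ → nof a∈ fa) , fa)
            ; (there (here refl)) → inj₁ (end∈P , gd)
            ; (there (there (here refl))) → inj₁ (w∈P , gb)
            ; (there (there (there (here refl)))) → inj₂ ((λ c∈ → nof c∈ fc) , fc) }

    -- Otherwise, walking from a to b in the connected graph H, every vertex met is equivalent to b,
    -- also the H-neighbour of b that is met last.
    equivalent-to-common⇒¬near : ∀ {a b c} → a ≈ b → a ≢ b → c ≈ b → c ≢ b → a ≢ c → ¬ NearPerfect G a c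
    equivalent-to-common⇒¬near {a} {b} {c} a≈b a≢b c≈b c≢b a≢c near =
      proj₁ (proj₂ (proj₂ (spread (conn⇒reach {G = H} (proj₁ oneExt a b))))) refl
      where
      spread : ∀ {v} → Reach H emptySet a v →
        ∃ λ c → (v ≈ b) × (v ≢ b) × (c ≈ b) × (c ≢ b) × (v ≢ c) × NearPerfect G v c
      spread (start _) = c , a≈b , a≢b , c≈b , c≢b , a≢c , near
      spread (step {w} {v} r e _) with spread r
      ... | c′ , w≈b , w≢b , c′≈b , c′≢b , w≢c′ , near′ =
        -- The previous vertex `w` becomes the companion of `v`: the edge of `H` between them
        -- supplies the near-perfect matching needed for the next step.
        w , neighbour w≈b w≢b c′≈b c′≢b w≢c′ near′ (H⊑G _ _ e) v≢b , v≢b , w≈b , w≢b ,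
        (λ v≡w → edge⇒≢ H e (≡-sym v≡w)) , edge⇒near (edge-sym H e)
        where
        v≢b : v ≢ b
        v≢b refl = ≈⇒¬near w≈b w≢b (edge⇒near e)

    ≈-trans : ∀ {x y z} → x ≈ y → y ≈ z → x ≈ z
    ≈-trans {x} {y} {z} x≈y y≈z with x ≈? z | x ≟ y | z ≟ y
    ... | yes x≈z | _ | _ = x≈z
    ... | no _ | yes refl | _ = y≈z
    ... | no _ | no _ | yes refl = x≈y
    ... | no x≉z | no x≢y | no z≢y =
      ⊥-elim (equivalent-to-common⇒¬near x≈y x≢y (≈-sym y≈z) z≢y (x≉z ∘ inj₁) (≉⇒near x≉z))

    class : Fin n → Subset n
    class x = tabulate (λ v → does (v ≈? x))

    ∈class⁺ : ∀ {v x} → v ≈ x → v ∈ class x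
    ∈class⁺ {v} {x} v≈x = ∈-tabulate⁺ (dec-true (v ≈? x) v≈x)

    ∈class⁻ : ∀ {v x} → v ∈ class x → v ≈ x
    ∈class⁻ {v} {x} v∈ = does⁻ (v ≈? x) (∈-tabulate⁻ v∈)

    class-≈ : ∀ {s t x} → s ∈ class x → t ∈ class x → s ≈ t
    class-≈ s∈ t∈ = ≈-trans (∈class⁻ s∈) (≈-sym (∈class⁻ t∈))

    class-≉ : ∀ {s w x} → s ∈ class x → w ∉ class x → ¬ w ≈ s
    class-≉ s∈ w∉ w≈s = w∉ (∈class⁺ (≈-trans w≈s (∈class⁻ s∈)))

    -- Gallai's argument and the barrier property of classes.

    module _ {x : Fin n} where

      private
        S = class x

      -- Gallai's argument, by induction on the walk from u to v.  Its last vertex w before v has w ≉ s; in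
      -- the union with a matching g missing w , s, the path from w ends at u (switch f, then add w v),
      -- at v (switch f, which then misses w instead of v), or at t (switch g, which then misses s , t).
      missed-in-component : ∀ {s t u v} → s ∈ S → t ∈ S → s ≢ t → Reach G S u v → u ≢ v →
        ∀ {f} → Matching G f → ¬ Misses f (u ∷ v ∷ s ∷ t ∷ [])
      missed-in-component s∈ t∈ s≢t (start _) u≢v = contradiction refl u≢v
      missed-in-component {s} {t} {u} {v} s∈ t∈ s≢t (step {w} r e v∉) u≢v {f} Mf miss-f with w ≟ u
      ... | yes refl = ≈⇒¬near (class-≈ s∈ t∈) s≢t (link u v f ,
              link-matching Mf (∈⇒missed miss-f (here refl)) (∈⇒missed miss-f (there (here refl))) e ,
              link-misses u≢v
                (λ { (here refl) → reach-source r s∈ ; (there (here refl)) → reach-source r t∈ })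
                (λ { (here refl) → v∉ s∈ ; (there (here refl)) → v∉ t∈ }) miss-f)
      ... | no w≢u with ≉⇒near (class-≉ s∈ (reach-target r))
      ...   | g , Mg , miss-g = bad (alternating-path f g (invol Mf) (invol Mg) gw fw)
        where
        w∉ = reach-target r
        u∉ = reach-source r
        w≢v : w ≢ v
        w≢v = edge⇒≢ G e
        fu = ∈⇒missed miss-f (here refl)
        fv = ∈⇒missed miss-f (there (here refl))
        fs = ∈⇒missed miss-f (there (there (here refl)))
        ft = ∈⇒missed miss-f (there (there (there (here refl))))
        gw = ∈⇒missed miss-g (here refl)
        gs = ∈⇒missed miss-g (there (here refl))
        fw : f w ≢ w
        fw eq with missed⇒∈ miss-f eq
        ... | here w≡u = w≢u w≡u
        ... | there (here w≡v) = w≢v w≡v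
        ... | there (there (here refl)) = w∉ s∈
        ... | there (there (there (here refl))) = w∉ t∈
        bad : AlternatingPath f g w → ⊥
        bad record
          { P = P ; closed-f = closed-f ; closed-g = closed-g ; w∈P = w∈P
          ; end = end ; end∈P = end∈P ; end≢w = end≢w ; ends = ends } = bad-ends ends
          where
          h = splice P g f
          Mh : Matching G h
          Mh = splice-matching Mg Mf closed-g closed-f
          bad-ends : PathEnds f g w P end → ⊥
          bad-ends (inj₂ (ge , nof , _)) with missed⇒∈ miss-g ge
          ... | here refl = end≢w refl
          ... | there (here refl) = nof end∈P fs
          bad-ends (inj₁ (fe , onlyf , onlyg)) = end-cases (missed⇒∈ miss-f fe)
            where
            s∉P : s ∉ P
            s∉P s∈P = w∉ (subst (_∈ S) (onlyg s∈P gs) s∈)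
            out-of : ∀ {y} → f y ≡ y → y ≢ end → y ∉ P
            out-of fy y≢ y∈ = y≢ (onlyf y∈ fy)
            u≢t : u ≢ t
            u≢t refl = u∉ t∈
            v≢t : v ≢ t
            v≢t refl = v∉ t∈
            end-cases : end ∈ˡ u ∷ v ∷ s ∷ t ∷ [] → ⊥
            end-cases (here refl) = ≈⇒¬near (class-≈ s∈ t∈) s≢t (link w v h ,
                link-matching Mh (∈⇒missed miss (here refl)) (∈⇒missed miss (there (here refl))) e ,
                link-misses w≢v
                  (λ { (here refl) → w∉ s∈ ; (there (here refl)) → w∉ t∈ })
                  (λ { (here refl) → v∉ s∈ ; (there (here refl)) → v∉ t∈ }) miss)
              where
              out : ∀ {y} → y ∉ P → f y ≡ y → y ∈ˡ w ∷ v ∷ s ∷ t ∷ []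
              out y∉ fy with missed⇒∈ miss-f fy
              ... | here refl = contradiction end∈P y∉
              ... | there y∈ = there y∈
              miss : Misses h (w ∷ v ∷ s ∷ t ∷ [])
              miss = splice-misses (λ y∈ gy → here (onlyg y∈ gy)) out λ
                { (here refl) → inj₁ (w∈P , gw)
                ; (there (here refl)) → inj₂ (out-of fv (u≢v ∘ ≡-sym) , fv)
                ; (there (there (here refl))) → inj₂ (s∉P , fs)
                ; (there (there (there (here refl)))) → inj₂ (out-of ft (u≢t ∘ ≡-sym) , ft) }
            end-cases (there (here refl)) =
              missed-in-component s∈ t∈ s≢t r (w≢u ∘ ≡-sym) Mh miss
              where
              out : ∀ {y} → y ∉ P → f y ≡ y → y ∈ˡ u ∷ w ∷ s ∷ t ∷ []
              out y∉ fy with missed⇒∈ miss-f fy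
              ... | here refl = here refl
              ... | there (here refl) = contradiction end∈P y∉
              ... | there (there y∈) = there (there y∈)
              miss : Misses h (u ∷ w ∷ s ∷ t ∷ [])
              miss = splice-misses (λ y∈ gy → there (here (onlyg y∈ gy))) out λ
                { (here refl) → inj₂ (out-of fu u≢v , fu)
                ; (there (here refl)) → inj₁ (w∈P , gw)
                ; (there (there (here refl))) → inj₂ (s∉P , fs)
                ; (there (there (there (here refl)))) → inj₂ (out-of ft (v≢t ∘ ≡-sym) , ft) }
            end-cases (there (there (here refl))) = s∉P end∈P
            end-cases (there (there (there (here refl)))) =
              ≈⇒¬near (class-≈ s∈ t∈) s≢t (splice P f g , splice-matching Mf Mg closed-f closed-g , miss)
              where
              out : ∀ {y} → y ∉ P → g y ≡ y → y ∈ˡ s ∷ t ∷ []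
              out y∉ gy with missed⇒∈ miss-g gy
              ... | here refl = contradiction w∈P y∉
              ... | there (here refl) = here refl
              miss : Misses (splice P f g) (s ∷ t ∷ [])
              miss = splice-misses (λ y∈ fy → there (here (onlyf y∈ fy))) out λ
                { (here refl) → inj₂ (s∉P , gs)
                ; (there (here refl)) → inj₁ (end∈P , ft) }

      module _ {f : Fin n → Fin n} (perf : Perfect H f) where

        private
          perfG : Perfect G f
          perfG = perfect-mono {G = H} {K = G} H⊑G perf
          M : Matching G f
          M = perfect⇒matching {G = G} perfG

        -- Deleting the edges of `f` at distinct `u` and `v` would leave a matching that misses just
        -- these and two distinct vertices of the class, which `missed-in-component` excludes.
        leaving-unique : ∀ {u v} → Reach G S u v → f u ∈ S → f v ∈ S → u ≡ v
        leaving-unique {u} {v} r fu∈ fv∈ with u ≟ v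
        ... | yes e = e
        ... | no u≢v = ⊥-elim (missed-in-component fu∈ fv∈ (u≢v ∘ injective M) r u≢v
                (unlink-matching (unlink-matching M refl) gv)
                (misses-resp to from (unlink-misses (unlink-misses (perfect⇒misses {G = G} perfG)))))
          where
          v≢fu : v ≢ f u
          v≢fu e = reach-target r (subst (_∈ S) (≡-sym e) fu∈)
          gv : unlink u (f u) f v ≡ f v
          gv = unlink-other u (f u) f (u≢v ∘ ≡-sym) v≢fu
          to : ∀ {y} → y ∈ˡ v ∷ f v ∷ u ∷ f u ∷ [] → y ∈ˡ u ∷ v ∷ f u ∷ f v ∷ []
          to (here e) = there (here e)
          to (there (here e)) = there (there (there (here e)))
          to (there (there (here e))) = here e
          to (there (there (there (here e)))) = there (there (here e))
          from : ∀ {y} → y ∈ˡ u ∷ v ∷ f u ∷ f v ∷ [] → y ∈ˡ v ∷ f v ∷ u ∷ f u ∷ []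
          from (here e) = there (there (here e))
          from (there (here e)) = here e
          from (there (there (here e))) = there (there (there (here e)))
          from (there (there (there (here e)))) = there (here e)

        mate∉class : ∀ {s} → s ∈ S → f s ∉ S
        mate∉class {s} s∈ fs∈ = ≈⇒¬near (class-≈ s∈ fs∈) (edge⇒≢ G (proj₁ (perfG s)))
          (matched⇒near {G = G} perfG refl)

        -- Used at both ends of the interval: `K` equal to `G` makes the class a barrier of `G`, and
        -- `K` equal to `H` makes it a barrier of `H`.
        module _ {K : Graph n} (H⊑K : H ⊑ K) (K⊑G : K ⊑ G) where

          -- All vertices of the component other than u are matched inside it.
          odd-component : ∀ {r u} → Reach K S r u → f u ∈ S → isOddᵇ ∣ component K S r ∣ ≡ true
          odd-component {r} {u} ru fu∈ =
            trans (cong isOddᵇ (∣p∣≡1+∣p-x∣ (∈component⁺ ru)))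
              (trans (isOdd-suc ∣ C - u ∣) (cong not (even-∣∣ f (invol M) (C - u) closed
                (λ {y} _ e → edge⇒≢ G (proj₁ (perfG y)) (≡-sym e)))))
            where
            C = component K S r
            closed : ∀ {y} → y ∈ C - u → f y ∈ C - u
            closed {y} y∈ = x∈p∧x≢y⇒x∈p-y
              (∈component⁺ (step ry (H⊑K _ _ (proj₁ (perf y))) fy∉))
              (λ fy≡u → reach-target ry (subst (_∈ S) (trans (cong f (≡-sym fy≡u)) (invol M y)) fu∈))
              where
              ry = ∈component⁻ (p─q⊆p C _ y∈)
              fy∉ : f y ∉ S
              fy∉ fy∈ = x∈p-y⇒x≢y y∈ (leaving-unique (reach-mono K⊑G (reach-trans (reach-sym ry) ru)) fy∈ fu∈)

          -- Each `s` is sent to the representative of the component of its partner. That component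
          -- is odd, and it determines `s` because only one edge of the matching joins it to the
          -- class.
          class≤odd : ∣ S ∣ ≤ odd K S
          class≤odd = subst (∣ S ∣ ≤_) (≡-sym (odd≡∣oddReps∣ K S))
            (∣∣-mono-injective S (oddReps K S) (λ s r → s ∈ S × Reach K S (f s) r) inj image)
            where
            inj : ∀ {s t r} → s ∈ S × Reach K S (f s) r → t ∈ S × Reach K S (f t) r → s ≡ t
            inj {s} {t} (s∈ , sr) (t∈ , tr) = injective M (leaving-unique
              (reach-mono K⊑G (reach-trans sr (reach-sym tr)))
              (subst (_∈ S) (≡-sym (invol M s)) s∈) (subst (_∈ S) (≡-sym (invol M t)) t∈))
            image : ∀ {s} → s ∈ S → ∃ λ r → r ∈ oddReps K S × s ∈ S × Reach K S (f s) r
            image {s} s∈ with rep-exists {G = K} (mate∉class s∈)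
            ... | r , rep , reach = r , ∈-tabulate⁺ (∧⁺ (IsRep⇒isRepᵇ rep)
                (trans (cong isOddᵇ (compSize≡ K S r))
                  (odd-component (reach-sym reach) (subst (_∈ S) (≡-sym (invol M s)) s∈)))) , s∈ , reach

          class-barrier : Barrier K S
          class-barrier = ≤-antisym (perfect⇒odd≤ (perfect-mono {G = H} {K = K} H⊑K perf)) class≤odd

-- Adding edges and saturating a graph.

module _ {n : ℕ} where

  -- Serves twice: with a single pair for saturation, and with all pairs inside the blocks of a
  -- cover set.
  module Augment (G : Graph n) {R : Fin n → Fin n → Set} (R? : ∀ u v → Dec (R u v))
                 (R-sym : ∀ {u v} → R u v → R v u) (R-irrefl : ∀ {v} → ¬ R v v) where

    private
      E? : ∀ u v → Dec (Edge G u v ⊎ R u v)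
      E? u v = edge? G u v ⊎-dec R? u v

      E-sym : ∀ {u v} → Edge G u v ⊎ R u v → Edge G v u ⊎ R v u
      E-sym (inj₁ e) = inj₁ (edge-sym G e)
      E-sym (inj₂ r) = inj₂ (R-sym r)

      E-irrefl : ∀ {v} → ¬ (Edge G v v ⊎ R v v)
      E-irrefl (inj₁ e) = edge⇒≢ G e refl
      E-irrefl (inj₂ r) = R-irrefl r

      flip : ∀ {u v} → does (E? u v) ≡ true → does (E? v u) ≡ true
      flip {u} {v} h = dec-true (E? v u) (E-sym (does⁻ (E? u v) h))

    graph : Graph n
    graph = record
      { adj = λ u v → does (E? u v)
      ; sym = λ u v → iff⇒≡ (flip {u} {v}) (flip {v} {u})
      ; irrefl = λ v → ≢true⇒false (E-irrefl ∘ does⁻ (E? v v)) }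

    edge⁺ : ∀ {u v} → Edge G u v ⊎ R u v → Edge graph u v
    edge⁺ {u} {v} = dec-true (E? u v)

    edge⁻ : ∀ {u v} → Edge graph u v → Edge G u v ⊎ R u v
    edge⁻ {u} {v} = does⁻ (E? u v)

    ⊑-graph : G ⊑ graph
    ⊑-graph u v e = edge⁺ (inj₁ e)

  module _ (G : Graph n) {x y : Fin n} (x≢y : x ≢ y) where

    private
      Pair : Fin n → Fin n → Set
      Pair u v = (u ≡ x × v ≡ y) ⊎ (u ≡ y × v ≡ x)

      pair-sym : ∀ {u v} → Pair u v → Pair v u
      pair-sym (inj₁ (u≡ , v≡)) = inj₂ (v≡ , u≡)
      pair-sym (inj₂ (u≡ , v≡)) = inj₁ (v≡ , u≡)

      pair-irrefl : ∀ {v} → ¬ Pair v v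
      pair-irrefl (inj₁ (refl , v≡)) = x≢y v≡
      pair-irrefl (inj₂ (refl , v≡)) = x≢y (≡-sym v≡)

      open Augment G {Pair} (λ u v → (u ≟ x ×-dec v ≟ y) ⊎-dec (u ≟ y ×-dec v ≟ x)) pair-sym pair-irrefl

    -- If adding `x y` changes `Φ`, a new perfect matching must contain `x y`; without that edge it
    -- is a matching of `G` missing just `x` and `y`.
    saturation-step : ∀ {H} → InE H G →
      (∃ λ K → G ⊑ K × InE H K × Edge K x y) ⊎ NearPerfect G x y
    saturation-step {H} inE@(H⊑G , _) with Φ graph ℕ.≟ Φ H
    ... | yes eq = inj₁ (graph , ⊑-graph , ((λ u v → ⊑-graph u v ∘ H⊑G u v) , eq) , edge⁺ (inj₂ (inj₁ (refl , refl))))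
    ... | no ne with new-perfect {H = H} {graph} (λ u v → ⊑-graph u v ∘ H⊑G u v) ne
    ...   | f , perf , ¬perfH with f x ≟ y
    ...     | no fx≢y = contradiction (inE⇒perfect {H = H} {G} inE perfG) ¬perfH
      where
      perfG : Perfect G f
      perfG v with perf v
      ... | e , ffv with edge⁻ e
      ...   | inj₁ eG = eG , ffv
      ...   | inj₂ (inj₁ (refl , fv)) = contradiction fv fx≢y
      ...   | inj₂ (inj₂ (refl , fv)) = contradiction (trans (cong f (≡-sym fv)) ffv) fx≢y
    ...     | yes fx≡y with matched⇒near {G = graph} perf fx≡y
    ...       | g , M , miss = inj₂ (g , record { invol = invol M ; edge = edgeG } , miss)
      where
      edgeG : ∀ {v} → g v ≢ v → Edge G v (g v)
      edgeG {v} gv≢v with edge⁻ (edge M gv≢v)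
      ... | inj₁ e = e
      ... | inj₂ (inj₁ (refl , _)) = contradiction (∈⇒missed miss (here refl)) gv≢v
      ... | inj₂ (inj₂ (refl , _)) = contradiction (∈⇒missed miss (there (here refl))) gv≢v

  maximal⇒saturated : ∀ {H G : Graph n} → MaximalInE H G → Saturated G
  maximal⇒saturated {H} {G} (inE , maximal) x y x≢y with saturation-step G x≢y {H} inE
  ... | inj₁ (K , G⊑K , inEK , e) = inj₁ (maximal K inEK G⊑K x y e)
  ... | inj₂ near = inj₂ near

  -- One pass over all pairs suffices: edges and near-perfect matchings survive the addition of
  -- edges, so a pair once settled stays settled.
  saturate : ∀ {H} G → InE H G → ∃ λ K → G ⊑ K × InE H K × Saturated K
  saturate {H} G inE with go G inE (cartesianProduct (allFinL n) (allFinL n))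
    where
    go : ∀ G → InE H G → ∀ ps → ∃ λ K → G ⊑ K × InE H K ×
         (∀ {x y} → (x , y) ∈ˡ ps → x ≢ y → Edge K x y ⊎ NearPerfect K x y)
    go G inE [] = G , (λ _ _ → id) , inE , λ ()
    go G inE ((x , y) ∷ ps) with x ≟ y
    ... | yes refl with go G inE ps
    ...   | K , G⊑K , inEK , sat = K , G⊑K , inEK , λ
              { (here refl) x≢x → contradiction refl x≢x ; (there p∈) → sat p∈ }
    go G inE ((x , y) ∷ ps) | no x≢y with saturation-step G x≢y {H} inE
    ... | inj₁ (G′ , G⊑G′ , inE′ , e) with go G′ inE′ ps
    ...   | K , G′⊑K , inEK , sat = K , (λ u v → G′⊑K u v ∘ G⊑G′ u v) , inEK , λ
              { (here refl) _ → inj₁ (G′⊑K _ _ e) ; (there p∈) → sat p∈ }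
    go G inE ((x , y) ∷ ps) | no x≢y | inj₂ near with go G inE ps
    ...   | K , G⊑K , inEK , sat = K , G⊑K , inEK , λ
              { (here refl) _ → inj₂ (near-mono {G = G} {K} G⊑K near) ; (there p∈) → sat p∈ }
  ... | K , G⊑K , inEK , sat = K , G⊑K , inEK , λ x y →
        sat (∈-cartesianProduct⁺ (∈-allFin x) (∈-allFin y))

  -- A perfect matching of `H` through such an edge would, with the edge deleted, miss just two
  -- vertices of the barrier.
  barrier⇒¬edge : ∀ {H G : Graph n} → OneExtendable H → H ⊑ G → ∀ {S} → Barrier G S → ∀ {s t} → s ∈ S → t ∈ S → ¬ Edge H s t
  barrier⇒¬edge {H} {G} oneExt H⊑G barrier s∈ t∈ e with extend {H = H} oneExt e
  ... | f , perf , fs = barrier⇒¬near {G = G} barrier s∈ t∈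
                          (near-mono {G = H} {G} H⊑G (matched⇒near {G = H} perf fs))

  -- Follows the walk until it first enters `S`. With `H` connected, this finds an edge from any
  -- component of `H - S` to a non-empty `S`.
  exit : ∀ {H : Graph n} {S u v} → u ∉ S → Reach H emptySet u v →
         Reach H S u v ⊎ ∃ λ a → Reach H S u a × ∃ λ b → Edge H a b × b ∈ S
  exit u∉ (start _) = inj₁ (start u∉)
  exit {S = S} u∉ (step {w} {v} r e _) with exit u∉ r
  ... | inj₂ found = inj₂ found
  ... | inj₁ r′ with v ∈? S
  ...   | yes v∈ = inj₂ (w , r′ , v , e , v∈)
  ...   | no v∉ = inj₁ (step r′ e v∉)

  -- Maximal barriers of a saturated graph.

  module MaximalBarriers {H G : Graph n} (oneExt : OneExtendable H) (inE : InE H G) (sat : Saturated G) where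

    open Kotzig oneExt inE sat

    private
      f₀ : Fin n → Fin n
      f₀ = lookup (proj₁ (proj₁ (proj₂ oneExt)))
      perf₀ : Perfect H f₀
      perf₀ = isPM⇒perfect {G = H} {proj₁ (proj₁ (proj₂ oneExt))} (proj₂ (proj₁ (proj₂ oneExt)))

    barrier⊆class : ∀ {T} → Barrier G T → ∀ {x} → x ∈ T → T ⊆ class x
    barrier⊆class barrier {x} x∈ {t} t∈ with t ≈? x
    ... | yes t≈x = ∈class⁺ t≈x
    ... | no t≉x = contradiction (≉⇒near t≉x) (barrier⇒¬near {G = G} barrier t∈ x∈)

    self∈class : ∀ {x} → x ∈ class x
    self∈class = ∈class⁺ (inj₁ refl)

    class-maxBarrier : ∀ x → MaxBarrier G (class x)
    class-maxBarrier x = class-barrier perf₀ H⊑G (λ _ _ → id) ,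
      λ T barrier class⊆T → barrier⊆class barrier (class⊆T self∈class)

    maxBarrier⇒class : ∀ {B} → MaxBarrier G B → ∀ {x} → x ∈ B → B ≡ class x
    maxBarrier⇒class (barrier , maximal) {x} x∈ = ⊆-antisym B⊆class
      (maximal (class x) (proj₁ (class-maxBarrier x)) B⊆class)
      where
      B⊆class = barrier⊆class barrier x∈

    -- An empty barrier is not maximal, since it lies in the class of `v`, again a barrier.
    maxBarrier-nonempty : ∀ {B} → MaxBarrier G B → Fin n → ∃ λ x → x ∈ B
    maxBarrier-nonempty {B} (_ , maximal) v with nonempty? B
    ... | yes nonempty = nonempty
    ... | no empty = v , maximal (class v) (proj₁ (class-maxBarrier v)) (λ x∈ → contradiction (_ , x∈) empty) self∈class

    -- By connectivity the component has an edge of `H` to the class. A perfect matching through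
    -- that edge shows the component to be odd, so the fixed matching `f₀` must leave it as well.
    leaves-component : ∀ {x u} → u ∉ class x → ∃ λ a → Reach H (class x) u a × f₀ a ∈ class x
    leaves-component {x} {u} u∉ with exit u∉ (conn⇒reach {G = H} (proj₁ oneExt u x))
    ... | inj₁ r = contradiction self∈class (reach-target r)
    ... | inj₂ (a , r , b , e , b∈) with extend {H = H} oneExt e
    ...   | f , perf , refl = odd⇒leaves (perfect⇒matching {G = H} perf₀)
              (λ {v} fv → contradiction (≡-sym fv) (edge⇒≢ H (proj₁ (perf₀ v))))
              (odd-component perf (λ _ _ → id) H⊑G r b∈)

    -- Each component of H - class x sends exactly one edge of the matching f₀ into the class, and
    -- so does each component of G - class x; so both graphs have the same components.
    equivalent⇒connected : ∀ {x u v} → u ≈ v → u ∉ class x → v ∉ class x → Reach H (class x) u v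
    equivalent⇒connected (inj₁ refl) u∉ _ = start u∉
    equivalent⇒connected {x} (inj₂ (e , _)) u∉ v∉ with leaves-component u∉ | leaves-component v∉
    ... | a , u→a , fa∈ | b , v→b , fb∈ with leaving-unique perf₀
            (reach-trans (reach-sym (reach-mono H⊑G u→a)) (reach-trans (step (start u∉) e v∉) (reach-mono H⊑G v→b))) fa∈ fb∈
    ...   | refl = reach-trans u→a (reach-sym v→b)

    maxBarriers-coverSet : Fin n → CoverSet H (MaxBarrier G)
    maxBarriers-coverSet v₀ = barrierH , nonconflicting ,
      (λ B max → maxBarrier-nonempty max v₀) ,
      (λ v → class v , class-maxBarrier v , self∈class) ,
      (λ v B B′ max max′ v∈ v∈′ → trans (maxBarrier⇒class max v∈) (≡-sym (maxBarrier⇒class max′ v∈′)))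
      where
      barrierH : ∀ B → MaxBarrier G B → Barrier H B
      barrierH B max with maxBarrier-nonempty max v₀
      ... | x , x∈ rewrite maxBarrier⇒class max x∈ = class-barrier perf₀ (λ _ _ → id) H⊑G

      one-component : ∀ {B₁ B₂} → MaxBarrier G B₁ → MaxBarrier G B₂ → ¬ MeetsTwoComponents H B₁ B₂
      one-component max₁ max₂ (x , y , x∈ , y∈ , x∉ , y∉ , c) with maxBarrier-nonempty max₂ v₀
      ... | z , z∈ with maxBarrier⇒class max₁ x∈ | maxBarrier⇒class max₂ z∈
      ...   | refl | refl = true≢false (reach⇒conn (equivalent⇒connected (≈-sym (∈class⁻ y∈)) x∉ y∉)) c

      nonconflicting : ∀ B₁ B₂ → MaxBarrier G B₁ → MaxBarrier G B₂ → ¬ B₁ ≡ B₂ → ¬ Conflict H B₁ B₂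
      nonconflicting B₁ B₂ max₁ max₂ ne (inj₁ (x , x∈₁ , x∈₂)) =
        ne (trans (maxBarrier⇒class max₁ x∈₁) (≡-sym (maxBarrier⇒class max₂ x∈₂)))
      nonconflicting B₁ B₂ max₁ max₂ ne (inj₂ (inj₁ meets)) = one-component max₁ max₂ meets
      nonconflicting B₁ B₂ max₁ max₂ ne (inj₂ (inj₂ meets)) = one-component max₂ max₁ meets

    -- Completing the blocks of a coarser cover set.

    module Coarser {𝓙 : Family n} (cover : CoverSet H 𝓙) (coarser : MaxBarrier G ≼ 𝓙) where

      private
        barrierH = proj₁ cover
        nonconflicting = proj₁ (proj₂ cover)
        covering = proj₁ (proj₂ (proj₂ (proj₂ cover)))
        unique = proj₂ (proj₂ (proj₂ (proj₂ cover)))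

        block : Fin n → Subset n
        block v = proj₁ (covering v)

        block∈ : ∀ v → 𝓙 (block v)
        block∈ v = proj₁ (proj₂ (covering v))

        self∈block : ∀ v → v ∈ block v
        self∈block v = proj₂ (proj₂ (covering v))

        SameBlock : Fin n → Fin n → Set
        SameBlock u v = u ≢ v × v ∈ block u

        sameBlock-sym : ∀ {u v} → SameBlock u v → SameBlock v u
        sameBlock-sym {u} {v} (u≢v , v∈) = u≢v ∘ ≡-sym ,
          subst (u ∈_) (unique v (block u) (block v) (block∈ u) (block∈ v) v∈ (self∈block v)) (self∈block u)

        open Augment G {SameBlock} (λ u v → ¬? (u ≟ v) ×-dec v ∈? block u) sameBlock-sym (λ r → proj₁ r refl)

        H⊑graph : H ⊑ graph
        H⊑graph u v = ⊑-graph u v ∘ H⊑G u v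

        block-connected : ∀ {J J′ u v} → 𝓙 J → 𝓙 J′ → u ∈ J′ → v ∈ J′ → u ∉ J → v ∉ J → Reach H J u v
        block-connected {J} {J′} {u} {v} J∈ J′∈ u∈ v∈ u∉ v∉ with connᵇ H J u v in c
        ... | true = conn⇒reach c
        ... | false = contradiction (inj₂ (inj₁ (u , v , u∈ , v∈ , u∉ , v∉ , c)))
                        (nonconflicting J′ J J′∈ J∈ (λ { refl → u∉ u∈ }))

        -- Each edge of `graph` outside `H` has both ends in one block: an added edge by
        -- construction, an edge of `G` because its ends share a class, which `coarser` puts into a
        -- block. Without conflicts, a block other than `J` stays within one component of `H - J`.
        graph-reach : ∀ {J u v} → 𝓙 J → Reach graph J u v → Reach H J u v
        graph-reach J∈ (start u∉) = start u∉
        graph-reach {J} J∈ (step {w} {v} r e v∉) = reach-trans (graph-reach J∈ r) (edge-reach (edge⁻ e))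
          where
          w∉ = reach-target r
          edge-reach : Edge G w v ⊎ SameBlock w v → Reach H J w v
          edge-reach (inj₂ (_ , v∈)) = block-connected J∈ (block∈ w) (self∈block w) v∈ w∉ v∉
          edge-reach (inj₁ eG) with edge? H w v
          ... | yes eH = step (start w∉) eH v∉
          ... | no ¬eH with coarser (class v) (class-maxBarrier v)
          ...   | J′ , J′∈ , class⊆ = block-connected J∈ J′∈ (class⊆ (∈class⁺ (inj₂ (eG , ¬eH)))) (class⊆ self∈class) w∉ v∉

        graph-barrier : ∀ {J} → 𝓙 J → Barrier graph J
        graph-barrier {J} J∈ = trans (odd-cong (graph-reach J∈) (reach-mono H⊑graph)) (barrierH J J∈)

        -- A perfect matching with an added edge would, after deletion of that edge, miss just two
        -- vertices of a block, which is a barrier of `graph`.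
        graph-inE : InE H graph
        graph-inE = perfect⇒inE {H = H} {graph} H⊑graph (λ {f} perf → inE⇒perfect {H = H} {G} inE (perfG perf))
          where
          perfG : ∀ {f} → Perfect graph f → Perfect G f
          perfG {f} perf v with edge⁻ (proj₁ (perf v))
          ... | inj₁ e = e , proj₂ (perf v)
          ... | inj₂ (_ , fv∈) = contradiction (matched⇒near {G = graph} perf refl)
                  (barrier⇒¬near {G = graph} (graph-barrier (block∈ v)) (self∈block v) fv∈)

      coarser⇒≼-maxBarriers : (∀ K → InE H K → G ⊑ K → K ⊑ G) → 𝓙 ≼ MaxBarrier G
      coarser⇒≼-maxBarriers maximal J J∈ with proj₁ (proj₂ (proj₂ cover)) J J∈
      ... | x , x∈ = class x , class-maxBarrier x , J⊆class
        where
        J⊆class : J ⊆ class x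
        J⊆class {y} y∈ with y ≟ x
        ... | yes refl = self∈class
        ... | no y≢x = ∈class⁺ (inj₂
          -- Maximality puts the edge `y x` into `G`, while `barrier⇒¬edge` keeps it out of `H`.
          ( maximal graph graph-inE ⊑-graph y x (edge⁺ (inj₂ (y≢x ,
              subst (x ∈_) (unique y J (block y) J∈ (block∈ y) y∈ (self∈block y)) x∈)))
          , barrier⇒¬edge oneExt H⊑graph (graph-barrier J∈) y∈ x∈))

  -- The two implications.

  maximal⇒cliques : ∀ {H G : Graph n} → MaximalInE H G → ∀ B → MaxBarrier G B → Clique G B
  maximal⇒cliques {H} {G} max B (barrier , _) u v u∈ v∈ u≢v with maximal⇒saturated {H} {G} max u v u≢v
  ... | inj₁ e = e
  ... | inj₂ near = contradiction near (barrier⇒¬near {G = G} barrier u∈ v∈)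

  maximal⇒maximalCoverSet : ∀ {H G : Graph n} → OneExtendable H → MaximalInE H G → Fin n →
                            MaximalCoverSet H (MaxBarrier G)
  maximal⇒maximalCoverSet {H} {G} oneExt max@(inE , maximal) v₀ =
    maxBarriers-coverSet v₀ , λ 𝓙 cover coarser → Coarser.coarser⇒≼-maxBarriers cover coarser maximal
    where
    open MaximalBarriers oneExt inE (maximal⇒saturated {H} {G} max)

  maximalCoverSet⇒maximal : ∀ {H G : Graph n} → OneExtendable H → InE H G → Fin n →
    (∀ B → MaxBarrier G B → Clique G B) → MaximalCoverSet H (MaxBarrier G) → MaximalInE H G
  maximalCoverSet⇒maximal {H} {G} oneExt inE@(H⊑G , _) v₀ cliques ((_ , _ , nonempty , _) , coarsest) =
    inE , maximal
    where
    maximal : ∀ G′ → InE H G′ → G ⊑ G′ → G′ ⊑ G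
    maximal G′ inE′ G⊑G′ u v e with saturate {H} G′ inE′
    ... | K , G′⊑K , inEK , sat = G-edge (coarsest (MaxBarrier K) (maxBarriers-coverSet v₀) refines)
      where
      open Kotzig oneExt inEK sat using (_≈_; class; ∈class⁺)
      open MaximalBarriers oneExt inEK sat
      refines : MaxBarrier G ≼ MaxBarrier K
      refines B max with nonempty B max
      ... | x , x∈ = class x , class-maxBarrier x , B⊆class
        where
        B⊆class : B ⊆ class x
        B⊆class {y} y∈ with y ≟ x
        ... | yes refl = self∈class
        -- The clique provides the edge in `G` and so in `K`; as both ends lie in a barrier of `G`,
        -- it is not an edge of `H`.
        ... | no y≢x = ∈class⁺ (inj₂ (G′⊑K _ _ (G⊑G′ _ _ (cliques B max y x y∈ x∈ y≢x)) ,
                         barrier⇒¬edge oneExt H⊑G (proj₁ max) y∈ x∈))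
      G-edge : MaxBarrier K ≼ MaxBarrier G → Edge G u v
      G-edge finer with edge? H u v
      ... | yes eH = H⊑G u v eH
      -- Outside `H`, the edge joins vertices equivalent in `K`, and `finer` puts their class inside
      -- a clique of `G`.
      ... | no ¬eH with finer (class v) (class-maxBarrier v)
      ...   | B , max , class⊆B = cliques B max u v (class⊆B (∈class⁺ (inj₂ (G′⊑K u v e , ¬eH))))
                                    (class⊆B self∈class) (edge⇒≢ G′ e)

theorem5p5 : ∀ (n : ℕ) (H G : Graph (suc n)) → OneExtendable H → InE H G →
    (MaximalInE H G ⇔
    ((∀ B → MaxBarrier G B → Clique G B) × MaximalCoverSet H (MaxBarrier G)))
theorem5p5 n H G oneExt inE = mk⇔
  -- Here `zero` is the vertex from which maximal barriers are seen to be non-empty.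
  (λ max → maximal⇒cliques {H = H} {G} max , maximal⇒maximalCoverSet oneExt max zero)
  (λ (cliques , maxCover) → maximalCoverSet⇒maximal oneExt inE zero cliques maxCover)
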